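{- Let $n\ge 4$ be an integer. Then $$r_{\mathrm{u}}(n,C_n)> n/4.$$
   Context: $K_n$ is the complete graph on $n$ vertices and $C_n$ is the cycle on $n$ vertices, so a copy of $C_n$ in $K_n$ is a Hamilton cycle. An $r$-coloring of $K_n$ is a map $\chi:E(K_n)\to[r]=\{1,\dots,r\}$ (not necessarily proper or surjective). For a graph $H$, the unique-Ramsey number $r_{\mathrm{u}}(n,H)$ is the minimum positive integer $r$ for which there is an $r$-coloring of $K_n$ such that in every (not necessarily induced) copy of $H$ in $K_n$ some color occurs on exactly one edge of that copy. -}

module Defs where

open import Data.Nat.Base using (ℕ; zero; suc; _*_; _^_; _≤_; z≤n; s≤s)
import Data.Nat.Properties as ℕ
open import Data.Fin.Base as Fin using (Fin; zero; suc; toℕ; inject₁; combine; remQuot; finToFun; funToFin)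
open import Data.Fin.Properties as Fin using (any?; all?; finToFun-funToFin; remQuot-combine; combine-injective; inject₁-injective)
open import Data.Product.Base using (Σ; ∃; ∃₂; ∃-syntax; _×_; _,_; proj₁; proj₂; uncurry)
open import Data.Sum.Base using (_⊎_; inj₁; inj₂; swap)
open import Function.Base using (_∘_)
open import Function.Definitions using (Injective)
open import Relation.Binary.Core using (Rel)
open import Relation.Binary.Definitions using (Symmetric; Irreflexive; Decidable)
open import Relation.Binary.PropositionalEquality.Core using (_≡_; refl; sym; trans; cong; cong₂)
open import Relation.Nullary.Decidable using (Dec; yes; no; map′; _×-dec_; _⊎-dec_; _→-dec_)
open import Relation.Nullary.Negation using (¬_; contradiction)
open import Level using (0ℓ)

private
  variable
    m n r : ℕ

record Graph (m : ℕ) : Set₁ where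
  field
    Adj    : Rel (Fin m) 0ℓ
    adj?   : Decidable Adj
    symm   : Symmetric Adj
    irrefl : Irreflexive _≡_ Adj

HasEdge : Graph m → Set
HasEdge H = ∃₂ λ u v → Graph.Adj H u v

Next : Rel (Fin n) 0ℓ
Next {n} i j = toℕ j ≡ suc (toℕ i) ⊎ (suc (toℕ i) ≡ n × toℕ j ≡ 0)

-- Below three vertices this relation would give a loop (n = 1) or a
-- single edge (n = 2), hence the hypothesis.
cycle : ∀ n → 3 ≤ n → Graph n
cycle n n≥3 = record
  { Adj    = λ i j → Next i j ⊎ Next j i
  ; adj?   = λ i j → next? i j ⊎-dec next? j i
  ; symm   = swap
  ; irrefl = λ { {i} refl (inj₁ p) → ¬loop n≥3 i p ; {i} refl (inj₂ p) → ¬loop n≥3 i p }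
  }
  where
  next? : Decidable (Next {n})
  next? i j = (toℕ j ℕ.≟ suc (toℕ i)) ⊎-dec ((suc (toℕ i) ℕ.≟ n) ×-dec (toℕ j ℕ.≟ 0))

  ¬loop : ∀ {n} → 3 ≤ n → (i : Fin n) → ¬ Next i i
  ¬loop _ i (inj₁ p) = ℕ.1+n≢n (sym p)
  ¬loop (s≤s (s≤s _)) zero (inj₂ (() , _))

cycle-hasEdge : ∀ n (n≥3 : 3 ≤ n) → HasEdge (cycle n n≥3)
cycle-hasEdge (suc (suc n)) (s≤s (s≤s _)) = zero , suc zero , inj₁ (inj₁ refl)

-- Edges of Kₙ are unordered pairs of distinct vertices, so a colouring is a
-- symmetric function; its values on the diagonal are never consulted.
record Colouring (n r : ℕ) : Set where
  field
    colour     : Fin n → Fin n → Fin r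
    colour-sym : ∀ u v → colour u v ≡ colour v u

SameEdge : Fin m → Fin m → Fin m → Fin m → Set
SameEdge u v u′ v′ = (u′ ≡ u × v′ ≡ v) ⊎ (u′ ≡ v × v′ ≡ u)

OnExactlyOneEdge : Graph m → (Fin m → Fin m → Fin r) → Fin r → Set
OnExactlyOneEdge H κ c =
  ∃₂ λ u v → Adj u v × κ u v ≡ c ×
    (∀ u′ v′ → Adj u′ v′ → κ u′ v′ ≡ c → SameEdge u v u′ v′)
  where open Graph H

-- A copy of H in Kₙ is the image of H under an injection φ of its vertices;
-- κ below is the colouring of that copy pulled back to the edges of H.
SomeColourOnce : Graph m → Colouring n r → (Fin m → Fin n) → Set
SomeColourOnce H χ φ = ∃[ c ] OnExactlyOneEdge H (λ u v → colour (φ u) (φ v)) c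
  where open Colouring χ

UniqueColouring : Graph m → Colouring n r → Set
UniqueColouring {m} {n} H χ =
  (φ : Fin m → Fin n) → Injective _≡_ _≡_ φ → SomeColourOnce H χ φ

Admissible : ∀ n → Graph m → ℕ → Set
Admissible n H r = 1 ≤ r × Σ (Colouring n r) (UniqueColouring H)

record IsUniqueRamsey (n : ℕ) (H : Graph m) (r : ℕ) : Set where
  field
    admissible : Admissible n H r
    minimal    : ∀ s → Admissible n H s → r ≤ s

-- Existence of the minimum: the condition is decidable, and it holds when all
-- edges of Kₙ receive different colours, provided H has an edge.

private
  resp-κ : (H : Graph m) {κ κ′ : Fin m → Fin m → Fin r} → (∀ u v → κ u v ≡ κ′ u v) →
           ∃ (OnExactlyOneEdge H κ) → ∃ (OnExactlyOneEdge H κ′)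
  resp-κ H eq (c , u , v , a , κ≡c , only) =
    c , u , v , a , trans (sym (eq u v)) κ≡c ,
    λ u′ v′ a′ e → only u′ v′ a′ (trans (eq u′ v′) e)

  injective? : (φ : Fin m → Fin n) → Dec (Injective _≡_ _≡_ φ)
  injective? φ = map′ (λ f {x} {y} → f x y) (λ f x y → f {x} {y})
    (all? λ x → all? λ y → (φ x Fin.≟ φ y) →-dec (x Fin.≟ y))

  someColourOnce? : (H : Graph m) (χ : Colouring n r) (φ : Fin m → Fin n) → Dec (SomeColourOnce H χ φ)
  someColourOnce? H χ φ =
    any? λ c → any? λ u → any? λ v → adj? u v ×-dec ((κ u v Fin.≟ c) ×-dec
      (all? λ u′ → all? λ v′ → adj? u′ v′ →-dec ((κ u′ v′ Fin.≟ c) →-dec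
        (((u′ Fin.≟ u) ×-dec (v′ Fin.≟ v)) ⊎-dec ((u′ Fin.≟ v) ×-dec (v′ Fin.≟ u))))))
    where
    open Graph H
    κ = λ u v → Colouring.colour χ (φ u) (φ v)

  uniqueColouring? : (H : Graph m) (χ : Colouring n r) → Dec (UniqueColouring H χ)
  uniqueColouring? {m} {n} H χ = map′ to (λ h k → h (finToFun k))
    (all? λ (k : Fin (n ^ m)) → injective? (finToFun k) →-dec someColourOnce? H χ (finToFun k))
    where
    open Colouring χ
    to : ((k : Fin (n ^ m)) → Injective _≡_ _≡_ (finToFun k) → SomeColourOnce H χ (finToFun k)) →
         UniqueColouring H χ
    to h φ inj = resp-κ H (λ u v → cong₂ colour (eq u) (eq v))
      (h (funToFin φ) λ {x} {y} e → inj (trans (sym (eq x)) (trans e (eq y))))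
      where eq = finToFun-funToFin φ

  table : Fin (r ^ (n * n)) → Fin n → Fin n → Fin r
  table k u v = finToFun k (combine u v)

  code : (Fin n → Fin n → Fin r) → Fin (r ^ (n * n))
  code {n} f = funToFin (uncurry f ∘ remQuot n)

  table-code : (f : Fin n → Fin n → Fin r) → ∀ u v → table (code f) u v ≡ f u v
  table-code {n} f u v = trans (finToFun-funToFin (uncurry f ∘ remQuot n) (combine u v))
    (cong (uncurry f) (remQuot-combine u v))

  admissible? : ∀ n (H : Graph m) r → Dec (Admissible n H r)
  admissible? n H r = (1 ℕ.≤? r) ×-dec map′ from to (any? good?)
    where
    Sym : (Fin n → Fin n → Fin r) → Set
    Sym f = ∀ u v → f u v ≡ f v u

    mk : (f : Fin n → Fin n → Fin r) → Sym f → Colouring n r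
    mk f s = record { colour = f ; colour-sym = s }

    Good : Fin (r ^ (n * n)) → Set
    Good k = Σ (Sym (table k)) λ s → UniqueColouring H (mk (table k) s)

    good? : ∀ k → Dec (Good k)
    good? k with all? (λ u → all? λ v → table k u v Fin.≟ table k v u)
    ... | no ¬s = no (¬s ∘ proj₁)
    ... | yes s = map′ (s ,_) proj₂ (uniqueColouring? H (mk (table k) s))

    from : ∃ Good → Σ (Colouring n r) (UniqueColouring H)
    from (k , s , h) = mk (table k) s , h

    to : Σ (Colouring n r) (UniqueColouring H) → ∃ Good
    to (χ , h) = code colour , s ,
      λ φ inj → resp-κ H (λ u v → sym (eq (φ u) (φ v))) (h φ inj)
      where
      open Colouring χ
      eq = table-code colour
      s : Sym (table (code colour))
      s u v = trans (eq u v) (trans (colour-sym u v) (sym (eq v u)))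

  pair : (u v : Fin n) → Fin n × Fin n
  pair u v with u Fin.≤? v
  ... | yes _ = u , v
  ... | no  _ = v , u

  pair-sym : (u v : Fin n) → pair u v ≡ pair v u
  pair-sym u v with u Fin.≤? v | v Fin.≤? u
  ... | yes p | yes q = cong₂ _,_ (Fin.≤-antisym p q) (Fin.≤-antisym q p)
  ... | yes _ | no  _ = refl
  ... | no  _ | yes _ = refl
  ... | no ¬p | no ¬q = contradiction (ℕ.<⇒≤ (ℕ.≰⇒> ¬p)) ¬q

  pair-sameEdge : (u v u′ v′ : Fin n) → pair u′ v′ ≡ pair u v → SameEdge u v u′ v′
  pair-sameEdge u v u′ v′ e with u Fin.≤? v | u′ Fin.≤? v′
  ... | yes _ | yes _ = inj₁ (cong proj₁ e , cong proj₂ e)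
  ... | yes _ | no  _ = inj₂ (cong proj₂ e , cong proj₁ e)
  ... | no  _ | yes _ = inj₂ (cong proj₁ e , cong proj₂ e)
  ... | no  _ | no  _ = inj₁ (cong proj₂ e , cong proj₁ e)

  rainbow : ∀ n → Colouring n (suc (n * n))
  rainbow n = record
    { colour     = λ u v → inject₁ (uncurry combine (pair u v))
    ; colour-sym = λ u v → cong (inject₁ ∘ uncurry combine) (pair-sym u v)
    }

  rainbow-admissible : ∀ n (H : Graph m) → HasEdge H → Admissible n H (suc (n * n))
  rainbow-admissible n H (u , v , a) = s≤s z≤n , rainbow n , λ φ inj →
    _ , u , v , a , refl , λ u′ v′ _ e → lift φ inj u′ v′
      (pair-sameEdge (φ u) (φ v) (φ u′) (φ v′) (unpair (inject₁-injective e)))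
    where
    unpair : {p q : Fin n × Fin n} → uncurry combine p ≡ uncurry combine q → p ≡ q
    unpair {i , j} {k , l} e with refl , refl ← combine-injective i j k l e = refl

    lift : ∀ φ → Injective _≡_ _≡_ φ → ∀ u′ v′ →
           SameEdge (φ u) (φ v) (φ u′) (φ v′) → SameEdge u v u′ v′
    lift φ inj u′ v′ (inj₁ (p , q)) = inj₁ (inj p , inj q)
    lift φ inj u′ v′ (inj₂ (p , q)) = inj₂ (inj p , inj q)

  least : (P : ℕ → Set) → (∀ k → Dec (P k)) → ∀ b → P b →
          ∃[ k ] P k × (∀ s → P s → k ≤ s)
  least P P? zero    p = 0 , p , λ _ _ → z≤n
  least P P? (suc b) p with P? 0
  ... | yes p₀ = 0 , p₀ , λ _ _ → z≤n
  ... | no ¬p₀ with k , pₖ , min ← least (P ∘ suc) (P? ∘ suc) b p =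
    suc k , pₖ , λ { zero p₀ → contradiction p₀ ¬p₀ ; (suc s) pₛ → s≤s (min s pₛ) }

uniqueRamsey-exists : ∀ n (H : Graph m) → HasEdge H → ∃ (IsUniqueRamsey n H)
uniqueRamsey-exists n H e
  with r , adm , min ← least (Admissible n H) (admissible? n H) (suc (n * n)) (rainbow-admissible n H e)
  = r , record { admissible = adm ; minimal = min }

rᵤ : ∀ n (H : Graph m) → HasEdge H → ℕ
rᵤ n H e = proj₁ (uniqueRamsey-exists n H e)

rᵤ-isUniqueRamsey : ∀ n (H : Graph m) (e : HasEdge H) → IsUniqueRamsey n H (rᵤ n H e)
rᵤ-isUniqueRamsey n H e = proj₂ (uniqueRamsey-exists n H e)

-- Suppose 4r ≤ n and choose vertex-disjoint monochromatic stars of pairwise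
-- distinct colours with two leaves (cherries) or three leaves (claws) such that
-- 5 · #cherries + 6 · #claws is maximal. Let R be the set of the remaining vertices
-- and k the number of colours not used by a star. Call an edge good if a star has
-- its colour. A vertex with too many bad edges of one colour could be made the
-- centre of a new star, so maximality bounds the bad edges: in each unused colour at
-- most 1 from a leaf of a claw or a vertex of R into R, even when the third leaves of
-- the other claws are added to R, and at most 2 from a leaf of a cherry into R. As
-- |R| ≥ 4k + #cherries, a Hamilton cycle with good edges only, which runs through
-- all the paths leaf–centre–leaf, can be built greedily. Every colour on it occurs
-- on both edges of such a path.

module Submission where

open import Defs
import Algebra.Solver.CommutativeMonoid as CMSolver
open import Data.Empty using (⊥; ⊥-elim)
open import Data.Fin.Base using (Fin; toℕ; fromℕ<)
open import Data.Fin.Properties as Fin using (toℕ<n; toℕ-injective; toℕ-fromℕ<)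
open import Data.Integer.Base as ℤ using (+_; +<+)
import Data.Integer.Properties as ℤ
open import Data.List.Base using (List; []; _∷_; _++_; length; filter; map; concatMap; allFin)
open import Data.List.Membership.DecPropositional using (_∈?_)
open import Data.List.Membership.Propositional using (_∈_; _∉_)
open import Data.List.Membership.Propositional.Properties
  using (∈-∃++; ∈-++⁺ˡ; ∈-++⁺ʳ; ∈-++⁻; ∈-map⁺; ∈-map⁻; ∈-filter⁻; ∈-allFin)
open import Data.List.Properties using (filter-accept; length-tabulate; length-++; length-map; ++-assoc; ++-identityʳ)
open import Data.List.Relation.Binary.Permutation.Propositional as ↭
  using (_↭_; ↭-refl; ↭-reflexive; ↭-prep; ↭-swap; ↭-sym; ↭-trans; ↭⇒↭ₛ)
open import Data.List.Relation.Binary.Permutation.Propositional.Properties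
  using (shift; shifts; ++⁺ˡ; ++⁺ʳ; ++⁺; map⁺; All-resp-↭; ∈-resp-↭; ↭-length; drop-∷; ++-comm; ++-commutativeMonoid)
import Data.List.Relation.Binary.Permutation.Setoid.Properties as ↭ₛ
open import Data.List.Relation.Binary.Sublist.Propositional using (_⊆_; ⊆-refl; []; _∷_; _∷ʳ_)
open import Data.List.Relation.Binary.Sublist.Propositional.Properties as Sublist using (All-resp-⊆)
open import Data.List.Relation.Unary.All as All using (All; []; _∷_)
open import Data.List.Relation.Unary.AllPairs as AllPairs using ([]; _∷_)
open import Data.List.Relation.Unary.Any using (here; there)
open import Data.List.Relation.Unary.Linked as Linked using (Linked; []; [-]; _∷_)
open import Data.List.Relation.Unary.Unique.Propositional using (Unique)
import Data.List.Relation.Unary.Unique.Propositional.Properties as Unique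
open import Data.Nat.Base
  using (ℕ; zero; suc; _+_; _*_; _≤_; _<_; _≥_; z≤n; s≤s; z<s)
open import Data.Nat.Properties
open import Data.Nat.Solver using (module +-*-Solver)
open import Data.Product.Base using (∃-syntax; ∃; ∃₂; _×_; _,_; proj₁; proj₂; map₁; map₂)
open import Data.Rational.Unnormalised.Base using (_/_; _>_; *<*)
open import Data.Sum.Base using (_⊎_; inj₁; inj₂; [_,_]′)
open import Function.Base using (_∘_; id)
open import Level using (0ℓ)
open import Relation.Binary.Core using (Rel)
open import Relation.Binary.Definitions using (Decidable; DecidableEquality; Symmetric)
open import Relation.Binary.PropositionalEquality.Core
  using (_≡_; _≢_; refl; sym; trans; cong; cong₂; subst; subst₂; ≢-sym; resp₂)
open import Relation.Binary.PropositionalEquality.Properties using (setoid)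
open import Relation.Nullary.Decidable using (Dec; yes; no; ¬?; decidable-stable)
open import Relation.Nullary.Negation using (¬_; contradiction)
open import Relation.Unary using (Pred)
import Relation.Unary as U

-- Finite selection and pigeonhole counting on lists

module _ {A : Set} where

  extract : ∀ {x : A} {xs} → x ∈ xs → ∃[ ys ] xs ↭ x ∷ ys
  extract x∈xs with as , bs , refl ← ∈-∃++ x∈xs = as ++ bs , shift _ as bs

  length-filter-split : {P : Pred A 0ℓ} (P? : U.Decidable P) (xs : List A) →
    length xs ≡ length (filter P? xs) + length (filter (λ x → ¬? (P? x)) xs)
  length-filter-split P? [] = refl
  length-filter-split P? (x ∷ xs) with P? x
  ... | yes _ = cong suc (length-filter-split P? xs)
  ... | no _  = trans (cong suc (length-filter-split P? xs)) (sym (+-suc _ _))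

  length-filter-filter : {P Q : Pred A 0ℓ} (P? : U.Decidable P) (Q? : U.Decidable Q) (xs : List A) →
    length (filter P? (filter Q? xs)) ≤ length (filter P? xs)
  length-filter-filter P? Q? [] = z≤n
  length-filter-filter P? Q? (x ∷ xs) with Q? x
  ... | yes _ with P? x
  ...   | yes _ = s≤s (length-filter-filter P? Q? xs)
  ...   | no _  = length-filter-filter P? Q? xs
  length-filter-filter P? Q? (x ∷ xs) | no _ with P? x
  ...   | yes _ = m≤n⇒m≤1+n (length-filter-filter P? Q? xs)
  ...   | no _  = length-filter-filter P? Q? xs

  inhabited : (xs : List A) → 0 < length xs → ∃[ x ] x ∈ xs
  inhabited (x ∷ _) _ = x , here refl

  pick₁ : {P : Pred A 0ℓ} (P? : U.Decidable P) (xs : List A) →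
          length (filter P? xs) < length xs → ∃[ x ] x ∈ xs × ¬ P x
  pick₁ P? (x ∷ xs) lt with P? x
  ... | no ¬p = x , here refl , ¬p
  ... | yes _ = map₂ (map₁ there) (pick₁ P? xs (≤-pred lt))

  pick₂ : {P Q : Pred A 0ℓ} (P? : U.Decidable P) (Q? : U.Decidable Q) (xs : List A) →
          length (filter P? xs) + length (filter Q? xs) < length xs →
          ∃[ x ] x ∈ xs × ¬ P x × ¬ Q x
  pick₂ P? Q? xs lt
    with x , x∈ , ¬p ← pick₁ P? (filter (λ x → ¬? (Q? x)) xs)
           (≤-<-trans (length-filter-filter P? _ xs)
             (+-cancelʳ-< (length (filter Q? xs)) _ _
               (<-≤-trans lt (≤-reflexive (trans (length-filter-split Q? xs) (+-comm (length (filter Q? xs)) _))))))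
    with x∈xs , ¬q ← ∈-filter⁻ (λ x → ¬? (Q? x)) {xs = xs} x∈
    = x , x∈xs , ¬p , ¬q

  module _ {B : Set} (_≟_ : DecidableEquality B) (f : A → B) where

    fibres-bound : ∀ m ys xs → (∀ {x} → x ∈ xs → f x ∈ ys) →
      (∀ {y} → y ∈ ys → length (filter (λ x → f x ≟ y) xs) ≤ m) → length xs ≤ m * length ys
    fibres-bound m [] [] into fib = z≤n
    fibres-bound m [] (x ∷ xs) into fib with () ← into (here refl)
    fibres-bound m (y ∷ ys) xs into fib = begin
      length xs                       ≡⟨ length-filter-split P? xs ⟩
      length (filter P? xs) + length rest
        ≤⟨ +-mono-≤ (fib (here refl)) (fibres-bound m ys rest into′ λ y∈ys →
             ≤-trans (length-filter-filter _ _ xs) (fib (there y∈ys))) ⟩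
      m + m * length ys               ≡⟨ *-suc m (length ys) ⟨
      m * suc (length ys)             ∎
      where
      open ≤-Reasoning
      P? = λ x → f x ≟ y
      rest = filter (λ x → ¬? (P? x)) xs
      into′ : ∀ {x} → x ∈ rest → f x ∈ ys
      into′ x∈ with ∈-filter⁻ (λ x → ¬? (P? x)) {xs = xs} x∈
      ... | x∈xs , f≢y with into x∈xs
      ...   | here f≡y = contradiction f≡y f≢y
      ...   | there i  = i

    injective-bound : ∀ {ys xs} → Unique xs → (∀ {x} → x ∈ xs → f x ∈ ys) →
      (∀ {p q} → p ∈ xs → q ∈ xs → p ≢ q → f q ≡ f p → ⊥) → length xs ≤ length ys
    injective-bound {ys} {xs} uxs into inj =
      subst (length xs ≤_) (*-identityˡ _) (fibres-bound 1 ys xs into λ {y} _ → fibre y)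
      where
      fibre : ∀ y → length (filter (λ x → f x ≟ y) xs) ≤ 1
      fibre y with filter (λ x → f x ≟ y) xs | (λ v → ∈-filter⁻ (λ x → f x ≟ y) {v = v} {xs = xs})
                 | Unique.filter⁺ (λ x → f x ≟ y) uxs
      ... | []     | _ | _ = z≤n
      ... | _ ∷ [] | _ | _ = s≤s z≤n
      ... | p ∷ q ∷ _ | sub | (p≢q ∷ _) ∷ _
        with p∈ , fp ← sub _ (here refl) | q∈ , fq ← sub _ (there (here refl))
        = ⊥-elim (inj p∈ q∈ p≢q (trans fq (sym fp)))

    two-to-one-bound : ∀ {ys xs} → Unique xs → (∀ {x} → x ∈ xs → f x ∈ ys) →
      (∀ {p q t} → p ∈ xs → q ∈ xs → t ∈ xs → p ≢ q → p ≢ t → q ≢ t → f q ≡ f p → f t ≡ f p → ⊥) →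
      length xs ≤ 2 * length ys
    two-to-one-bound {ys} {xs} uxs into inj = fibres-bound 2 ys xs into λ {y} _ → fibre y
      where
      fibre : ∀ y → length (filter (λ x → f x ≟ y) xs) ≤ 2
      fibre y with filter (λ x → f x ≟ y) xs | (λ v → ∈-filter⁻ (λ x → f x ≟ y) {v = v} {xs = xs})
                 | Unique.filter⁺ (λ x → f x ≟ y) uxs
      ... | []     | _ | _ = z≤n
      ... | _ ∷ [] | _ | _ = s≤s z≤n
      ... | _ ∷ _ ∷ [] | _ | _ = s≤s (s≤s z≤n)
      ... | p ∷ q ∷ t ∷ _ | sub | (p≢q ∷ p≢t ∷ _) ∷ (q≢t ∷ _) ∷ _
        with p∈ , fp ← sub _ (here refl) | q∈ , fq ← sub _ (there (here refl))
           | t∈ , ft ← sub _ (there (there (here refl)))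
        = ⊥-elim (inj p∈ q∈ t∈ p≢q p≢t q≢t (trans fq (sym fp)) (trans ft (sym fp)))

  Unique-resp-↭ : ∀ {xs ys : List A} → xs ↭ ys → Unique xs → Unique ys
  Unique-resp-↭ xs↭ys =
    ↭ₛ.AllPairs-resp-↭ (setoid A) ≢-sym (resp₂ _≢_) (↭⇒↭ₛ xs↭ys)

  Unique-resp-⊆ : ∀ {xs ys : List A} → xs ⊆ ys → Unique ys → Unique xs
  Unique-resp-⊆ []         []           = []
  Unique-resp-⊆ (_ ∷ʳ p)   (_ ∷ u)      = Unique-resp-⊆ p u
  Unique-resp-⊆ (refl ∷ p) (x∉ ∷ u)     = All-resp-⊆ p x∉ ∷ Unique-resp-⊆ p u

-- Greedy insertion into a path of good edges

module Insertion {A : Set} (Bad : Rel A 0ℓ) (bad? : Decidable Bad) where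

  open ≤-Reasoning
  open +-*-Solver

  Good : Rel A 0ℓ
  Good x y = ¬ Bad x y

  bad : A → List A → ℕ
  bad x ys = length (filter (bad? x) ys)

  -- If u fits into no gap of z ∷ zs, then no two consecutive entries are both good for u.
  insert-or-count : Symmetric Bad → ∀ u x z zs → Linked Good (z ∷ zs ++ x ∷ []) →
    (∃[ zs′ ] z ∷ zs′ ↭ u ∷ z ∷ zs × Linked Good (z ∷ zs′ ++ x ∷ [])) ⊎
    length (z ∷ zs) ≤ suc (2 * bad u (z ∷ zs))
  -- The gap before `x` is never tried, so the last entry stays next to `x`. That entry may itself
  -- be good for `u`, which accounts for the `suc` in the bound.
  insert-or-count bsym u x z [] _ = inj₂ (s≤s z≤n)
  insert-or-count bsym u x z (z₂ ∷ zs) (g ∷ gs) with bad? u z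
  ... | yes _ with insert-or-count bsym u x z₂ zs gs
  ...   | inj₁ (zs′ , p , gs′) = inj₁ (z₂ ∷ zs′ , ↭-trans (↭-prep z p) (↭-swap z u ↭-refl) , g ∷ gs′)
  ...   | inj₂ l = inj₂ (≤-trans (s≤s l) (s≤s (≤-trans (n≤1+n _) (≤-reflexive (sym (*-suc 2 _))))))
  insert-or-count bsym u x z (z₂ ∷ zs) (g ∷ gs) | no ¬b with bad? u z₂
  ... | no ¬b₂ = inj₁ (u ∷ z₂ ∷ zs , ↭-swap z u ↭-refl , ¬b ∘ bsym ∷ ¬b₂ ∷ gs)
  insert-or-count bsym u x z (z₂ ∷ []) gs | no ¬b | yes _ = inj₂ (s≤s (s≤s z≤n))
  -- The bad entry `z₂` pays for the good entry `z` before it, so the search skips both; this is the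
  -- factor 2.
  insert-or-count bsym u x z (z₂ ∷ z₃ ∷ zs) (g ∷ g₂ ∷ gs) | no ¬b | yes _
    with insert-or-count bsym u x z₃ zs gs
  ... | inj₁ (zs′ , p , gs′) =
    inj₁ (z₂ ∷ z₃ ∷ zs′ , ↭-trans (↭-prep z (↭-trans (↭-prep z₂ p) (↭-swap z₂ u ↭-refl))) (↭-swap z u ↭-refl) , g ∷ g₂ ∷ gs′)
  ... | inj₂ l = inj₂ (≤-trans (s≤s (s≤s l)) (≤-reflexive (cong suc (sym (*-suc 2 _)))))

  module _ (bsym : Symmetric Bad) (Pool : Pred A 0ℓ) (k : ℕ) (k≥1 : 1 ≤ k)
    (deg : ∀ {v} → Pool v → ∀ W → Unique (v ∷ W) → All Pool W → bad v W ≤ k) where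

    -- If more than 2k vertices are left in U, one of them is good for both r₀ and y.
    -- Below that, a u blocked everywhere has k + 1 bad neighbours among those placed;
    -- as long as more than k are left, this needs u to be chosen good for y.
    insert-one : ∀ r₀ x y ys U → Unique (r₀ ∷ y ∷ ys ++ U) → All Pool (r₀ ∷ y ∷ ys ++ U) →
      0 < length U → 4 * k < 2 + length ys + length U → Linked Good (r₀ ∷ y ∷ ys ++ x ∷ []) →
      ∃₂ λ u U′ → ∃ λ zs → U ↭ u ∷ U′ × zs ↭ u ∷ y ∷ ys × Linked Good (r₀ ∷ zs ++ x ∷ [])
    insert-one r₀ x y ys U uniq pool U≠[] big (g ∷ gs) = choose (length U ≤? 2 * k) (length U ≤? k)
      where
      Result = ∃₂ λ u U′ → ∃ λ zs → U ↭ u ∷ U′ × zs ↭ u ∷ y ∷ ys × Linked Good (r₀ ∷ zs ++ x ∷ [])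

      bad-r₀ : bad r₀ U ≤ k
      bad-r₀ = deg (All.head pool) U (Unique-resp-⊆ (refl ∷ Sublist.++⁺ˡ (y ∷ ys) ⊆-refl) uniq)
                 (All-resp-⊆ (Sublist.++⁺ˡ (r₀ ∷ y ∷ ys) ⊆-refl) pool)

      bad-y : bad y U ≤ k
      bad-y = deg (All.head (All.tail pool)) U (Unique-resp-⊆ (r₀ ∷ʳ refl ∷ Sublist.++⁺ˡ ys ⊆-refl) uniq)
                (All-resp-⊆ (Sublist.++⁺ˡ (r₀ ∷ y ∷ ys) ⊆-refl) pool)

      bad-placed : ∀ {u} → u ∈ U → bad u (r₀ ∷ y ∷ ys) ≤ k
      bad-placed u∈ with U′ , U↭ ← extract u∈
        with σ ← ↭-trans (++⁺ˡ (r₀ ∷ y ∷ ys) U↭) (shift _ (r₀ ∷ y ∷ ys) U′)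
        with All._∷_ pu _ ← All-resp-↭ σ pool
        = deg pu (r₀ ∷ y ∷ ys) (Unique-resp-⊆ (refl ∷ ⊆-++ʳ) (Unique-resp-↭ σ uniq)) (All-resp-⊆ ⊆-++ʳ pool)
        where
        ⊆-++ʳ : ∀ {ws} → r₀ ∷ y ∷ ys ⊆ r₀ ∷ y ∷ ys ++ ws
        ⊆-++ʳ {ws} = Sublist.++⁺ʳ ws ⊆-refl

      few : length U ≤ 2 * k → 2 * k ≤ length (y ∷ ys)
      few U≤2k = ≤-pred (+-cancelʳ-≤ (2 * k) _ _ (begin
        suc (2 * k + 2 * k)          ≡⟨ cong suc (solve 1 (λ k → con 2 :* k :+ con 2 :* k := con 4 :* k) refl k) ⟩
        suc (4 * k)                  ≤⟨ big ⟩
        2 + length ys + length U     ≤⟨ +-monoʳ-≤ _ U≤2k ⟩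
        2 + length ys + 2 * k        ∎))

      choose : Dec (length U ≤ 2 * k) → Dec (length U ≤ k) → Result
      choose (no U≰2k) _
        with u , u∈U , ¬b , ¬b₂ ← pick₂ (bad? r₀) (bad? y) U (≤-<-trans
               (≤-trans (+-mono-≤ bad-r₀ bad-y) (≤-reflexive (cong (λ m → k + m) (sym (+-identityʳ k))))) (≰⇒> U≰2k))
        with U′ , U↭ ← extract u∈U
        = u , U′ , u ∷ y ∷ ys , U↭ , ↭-refl , ¬b ∷ ¬b₂ ∘ bsym ∷ gs
      choose (yes U≤2k) (no U≰k)
        with u , u∈U , ¬b ← pick₁ (bad? y) U (≤-<-trans bad-y (≰⇒> U≰k))
        with U′ , U↭ ← extract u∈U
        with bad? u r₀
      ... | no ¬b₀ = u , U′ , u ∷ y ∷ ys , U↭ , ↭-refl , ¬b₀ ∘ bsym ∷ ¬b ∘ bsym ∷ gs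
      ... | yes b₀ with insert-or-count bsym u x y ys gs
      ...   | inj₁ (zs , p , gs′) = u , U′ , y ∷ zs , U↭ , p , g ∷ gs′
      -- The bad neighbour `r₀` lies outside `y ∷ ys`, so at most `k - 1` bad neighbours remain
      -- there and the blocked list has at most `2 * k - 1` entries, while `few` gives `2 * k`.
      ...   | inj₂ len = ⊥-elim (<-irrefl refl (begin-strict
        suc (2 * bad u (y ∷ ys)) <⟨ ≤-reflexive (sym (*-suc 2 _)) ⟩
        2 * suc (bad u (y ∷ ys)) ≡⟨ cong (λ zs → 2 * length zs) (filter-accept (bad? u) b₀) ⟨
        2 * bad u (r₀ ∷ y ∷ ys)  ≤⟨ *-monoʳ-≤ 2 (bad-placed u∈U) ⟩
        2 * k                    ≤⟨ few U≤2k ⟩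
        length (y ∷ ys)          ≤⟨ len ⟩
        suc (2 * bad u (y ∷ ys)) ∎))
      choose (yes _) (yes U≤k)
        with u , u∈U ← inhabited U U≠[]
        with U′ , U↭ ← extract u∈U
        with insert-or-count bsym u x r₀ (y ∷ ys) (g ∷ gs)
      ... | inj₁ (zs , p , gs′) = u , U′ , zs , U↭ , drop-∷ (↭-trans p (↭-swap u r₀ ↭-refl)) , gs′
      -- Blocked everywhere, the path from `r₀` has at most `2 * k + 1` vertices. With at most `k`
      -- free ones the total is at most `3 * k + 1`, hence at most `4 * k` because `k` is positive.
      ... | inj₂ len = ⊥-elim (<-irrefl refl (begin-strict
          3 * k + k                      ≡⟨ solve 1 (λ k → con 3 :* k :+ k := con 4 :* k) refl k ⟩
          4 * k                          <⟨ big ⟩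
          2 + length ys + length U       ≤⟨ +-mono-≤ len U≤k ⟩
          suc (2 * bad u (r₀ ∷ y ∷ ys)) + k  ≤⟨ +-monoˡ-≤ k (s≤s (*-monoʳ-≤ 2 (bad-placed u∈U))) ⟩
          suc (2 * k) + k                ≤⟨ +-monoˡ-≤ k (+-monoˡ-≤ (2 * k) k≥1) ⟩
          3 * k + k                      ∎))

    -- An insertion moves one vertex from the free list to the path, so their total and with it the
    -- size condition are preserved along the induction.
    insert-all : ∀ m r₀ x y ys U → length U ≡ m → Unique (r₀ ∷ y ∷ ys ++ U) → All Pool (r₀ ∷ y ∷ ys ++ U) →
      4 * k < 2 + length ys + length U → Linked Good (r₀ ∷ y ∷ ys ++ x ∷ []) →
      ∃ λ zs → zs ↭ y ∷ ys ++ U × Linked Good (r₀ ∷ zs ++ x ∷ [])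
    insert-all zero r₀ x y ys [] refl uniq pool big gs = y ∷ ys , ↭-reflexive (cong (y ∷_) (sym (++-identityʳ ys))) , gs
    insert-all (suc m) r₀ x y ys U len uniq pool big gs
      with insert-one r₀ x y ys U uniq pool (subst (0 <_) (sym len) z<s) big gs
    ... | u , U′ , [] , U↭ , zs↭ , gs′ with () ← ↭-length zs↭
    ... | u , U′ , z ∷ zs , U↭ , zs↭ , gs′
      with σ ← ↭-trans (++⁺ʳ U′ zs↭) (↭-sym (↭-trans (++⁺ˡ (y ∷ ys) U↭) (shift u (y ∷ ys) U′)))
      with ws , ws↭ , gs″ ← insert-all m r₀ x z zs U′ (suc-injective (trans (sym (↭-length U↭)) len))
             (Unique-resp-↭ (↭-prep r₀ (↭-sym σ)) uniq) (All-resp-↭ (↭-prep r₀ (↭-sym σ)) pool)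
             (subst (4 * k <_) (cong suc (trans (sym (length-++ (y ∷ ys))) (trans (sym (↭-length σ)) (length-++ (z ∷ zs))))) big) gs′
      = ws , ↭-trans ws↭ σ , gs″

    -- The end `x` may lie outside the pool and has only the weaker bound `2 * k`. Its neighbour `y`
    -- is therefore fixed first, good for both `x` and `r₀`, and every later insertion falls between
    -- `r₀` and `y`.
    arrange : ∀ r₀ x U → Unique (r₀ ∷ U) → All Pool (r₀ ∷ U) → 4 * k ≤ length U → bad x U ≤ 2 * k →
      ∃ λ zs → zs ↭ U × Linked Good (r₀ ∷ zs ++ x ∷ [])
    arrange r₀ x U uniq pool big bad-x
      with y , y∈U , ¬b , ¬b₀ ← pick₂ (bad? x) (bad? r₀) U (begin-strict
             bad x U + bad r₀ U  ≤⟨ +-mono-≤ bad-x (deg (All.head pool) U uniq (All.tail pool)) ⟩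
             2 * k + k           <⟨ m<m+n _ k≥1 ⟩
             2 * k + k + k       ≡⟨ solve 1 (λ k → con 2 :* k :+ k :+ k := con 4 :* k) refl k ⟩
             4 * k               ≤⟨ big ⟩
             length U            ∎)
      with U′ , U↭ ← extract y∈U
      with zs , zs↭ , gs ← insert-all _ r₀ x y [] U′ refl (Unique-resp-↭ (↭-prep r₀ U↭) uniq)
             (All-resp-↭ (↭-prep r₀ U↭) pool) (s≤s (≤-trans big (≤-reflexive (↭-length U↭))))
             (¬b₀ ∷ ¬b ∘ bsym ∷ [-])
      = zs , ↭-trans zs↭ (↭-sym U↭) , gs

-- Permutations of concatenated lists

module _ {A : Set} where

  concatMap-↭ : ∀ {B : Set} (f : A → List B) {xs ys} → xs ↭ ys → concatMap f xs ↭ concatMap f ys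
  concatMap-↭ f ↭.refl         = ↭-refl
  concatMap-↭ f (↭.prep x p)   = ++⁺ˡ (f x) (concatMap-↭ f p)
  concatMap-↭ f (↭.swap x y p) = ↭-trans (++⁺ˡ (f x) (++⁺ˡ (f y) (concatMap-↭ f p))) (shifts (f x) (f y))
  concatMap-↭ f (↭.trans p q)  = ↭-trans (concatMap-↭ f p) (concatMap-↭ f q)

  ∈-tail : ∀ {x y : A} {xs} → x ∈ y ∷ xs → x ≢ y → x ∈ xs
  ∈-tail (here x≡y) x≢y = contradiction x≡y x≢y
  ∈-tail (there i)  _   = i

  extract₃ : ∀ {p q t : A} {xs} → p ∈ xs → q ∈ xs → t ∈ xs → p ≢ q → p ≢ t → q ≢ t →
             ∃[ ys ] xs ↭ p ∷ q ∷ t ∷ ys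
  extract₃ p∈ q∈ t∈ p≢q p≢t q≢t
    with ys , xs↭ ← extract p∈
    with zs , ys↭ ← extract (∈-tail (∈-resp-↭ xs↭ q∈) (≢-sym p≢q))
    with ws , zs↭ ← extract (∈-tail (∈-resp-↭ ys↭ (∈-tail (∈-resp-↭ xs↭ t∈) (≢-sym p≢t))) (≢-sym q≢t))
    = ws , ↭-trans xs↭ (↭-prep _ (↭-trans ys↭ (↭-prep _ zs↭)))

  open CMSolver (++-commutativeMonoid {A = A}) public using (_⊕_) renaming (solve to ↭-solve; _⊜_ to infix 4 _≗_)

-- Systems of disjoint stars and the exchanges that raise their value

module Configurations {n r : ℕ} (χ : Colouring n r) where
  open Colouring χ

  record Cherry : Set where
    field
      hue        : Fin r
      lf ctr rt  : Fin n
      lf-hue     : colour ctr lf ≡ hue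
      rt-hue     : colour ctr rt ≡ hue

    verts : List (Fin n)
    verts = lf ∷ ctr ∷ rt ∷ []

  -- The tip is kept apart because only the path `lf`-`ctr`-`rt` is placed on the cycle as a block;
  -- the tip serves as a free vertex later.
  record Claw : Set where
    field
      cherry : Cherry
    open Cherry cherry public using (hue; lf; ctr; rt; lf-hue; rt-hue)
    field
      tip     : Fin n
      tip-hue : colour ctr tip ≡ hue

    verts : List (Fin n)
    verts = tip ∷ Cherry.verts cherry

  -- Stating the partitions as permutations of `allFin` gives disjointness of the stars,
  -- distinctness of their hues and the vertex and colour counts at once.
  record Config : Set where
    field
      Cs : List Cherry
      Ds : List Claw
      R  : List (Fin n)
      K  : List (Fin r)  -- the colours of no star
      all-verts : concatMap Cherry.verts Cs ++ concatMap Claw.verts Ds ++ R ↭ allFin n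
      all-hues  : map Cherry.hue Cs ++ map Claw.hue Ds ++ K ↭ allFin r

    -- These are the vertices that can be moved to `R` at a loss of at most 1 in value each.
    pool : List (Fin n)
    pool = map Claw.tip Ds ++ R

    -- The weights make demoting three claws to gain one cherry profitable.
    value : ℕ
    value = 5 * length Cs + 6 * length Ds

  open Config

  hue-count : ∀ F → length (Cs F) + (length (Ds F) + length (K F)) ≡ r
  hue-count F = trans
    (cong₂ _+_ (sym (length-map Cherry.hue (Cs F)))
      (trans (cong (_+ length (K F)) (sym (length-map Claw.hue (Ds F)))) (sym (length-++ (map Claw.hue (Ds F))))))
    (trans (sym (length-++ (map Cherry.hue (Cs F)))) (trans (↭-length (all-hues F)) (length-tabulate id)))

  value-bound : ∀ F → value F ≤ 6 * r
  value-bound F = begin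
    5 * a + 6 * b             ≤⟨ +-mono-≤ (*-monoˡ-≤ a (n≤1+n 5)) (*-monoʳ-≤ 6 (m≤m+n b (length (K F)))) ⟩
    6 * a + 6 * (b + length (K F)) ≡⟨ *-distribˡ-+ 6 a _ ⟨
    6 * (a + (b + length (K F)))   ≡⟨ cong (6 *_) (hue-count F) ⟩
    6 * r                     ∎
    where
    open ≤-Reasoning
    a = length (Cs F)
    b = length (Ds F)

  -- Leaving `C` and `x` open allows any of the three leaves to be freed, not only the tip.
  demote : ∀ F {D Ds′} → Ds F ↭ D ∷ Ds′ → ∀ C x → Cherry.hue C ≡ Claw.hue D →
           x ∷ Cherry.verts C ↭ Claw.verts D → Config
  demote F {D} {Ds′} Ds↭ C x h v = record
    { Cs = C ∷ Cs F
    ; Ds = Ds′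
    ; R  = x ∷ R F
    ; K  = K F
    ; all-verts = ↭-trans
        (↭-solve 5 (λ x c cs ds r → (c ⊕ cs) ⊕ (ds ⊕ (x ⊕ r)) ≗ cs ⊕ (((x ⊕ c) ⊕ ds) ⊕ r)) ↭-refl
          (x ∷ []) (Cherry.verts C) (concatMap Cherry.verts (Cs F)) (concatMap Claw.verts Ds′) (R F))
        (↭-trans (++⁺ˡ (concatMap Cherry.verts (Cs F)) (++⁺ʳ (R F)
          (↭-trans (++⁺ʳ _ v) (↭-sym (concatMap-↭ Claw.verts Ds↭))))) (all-verts F))
    ; all-hues = ↭-trans
        (↭-solve 4 (λ c cs ds k → (c ⊕ cs) ⊕ (ds ⊕ k) ≗ cs ⊕ ((c ⊕ ds) ⊕ k)) ↭-refl
          (Cherry.hue C ∷ []) (map Cherry.hue (Cs F)) (map Claw.hue Ds′) (K F))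
        (↭-trans (++⁺ˡ (map Cherry.hue (Cs F)) (++⁺ʳ (K F)
          (↭-trans (↭-reflexive (cong (_∷ _) h)) (↭-sym (map⁺ Claw.hue Ds↭))))) (all-hues F))
    }

  demote-value : ∀ F {D Ds′} (Ds↭ : Ds F ↭ D ∷ Ds′) C x h v → value F ≡ suc (value (demote F Ds↭ C x h v))
  demote-value F {D} {Ds′} Ds↭ C x h v = trans (cong (λ m → 5 * length (Cs F) + 6 * m) (↭-length Ds↭))
    (solve 2 (λ c d → con 5 :* c :+ con 6 :* (con 1 :+ d) := con 1 :+ (con 5 :* (con 1 :+ c) :+ con 6 :* d)) refl
      (length (Cs F)) (length Ds′))
    where open +-*-Solver

  -- A vertex of `R` is free already, and a tip is freed by demoting its claw. The inclusions and
  -- the equality of `K` allow several releases in a row.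
  release : ∀ F {p} → p ∈ pool F → ∃[ G ] p ∈ R G × (∀ {q} → q ∈ R F → q ∈ R G) ×
            (∀ {q} → q ∈ pool F → q ∈ pool G) × K G ≡ K F × value F ≤ suc (value G)
  release F p∈ with ∈-++⁻ (map Claw.tip (Ds F)) p∈
  ... | inj₂ p∈R = F , p∈R , (λ i → i) , (λ i → i) , refl , n≤1+n _
  ... | inj₁ p∈tips
    with D , D∈ , refl ← ∈-map⁻ Claw.tip p∈tips
    with Ds′ , Ds↭ ← extract D∈
    = demote F Ds↭ (Claw.cherry D) (Claw.tip D) refl ↭-refl , here refl , there ,
      ∈-resp-↭ (↭-trans (++⁺ʳ (R F) (map⁺ Claw.tip Ds↭)) (↭-sym (shift _ (map Claw.tip Ds′) (R F)))) , refl ,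
      ≤-reflexive (demote-value F Ds↭ (Claw.cherry D) (Claw.tip D) refl ↭-refl)

  add-cherry : ∀ F {p u q c R′ K′} → R F ↭ p ∷ u ∷ q ∷ R′ → K F ↭ c ∷ K′ →
               colour u p ≡ c → colour u q ≡ c → Config
  add-cherry F {p} {u} {q} {c} {R′} {K′} R↭ K↭ up uq = record
    { Cs = record { hue = c ; lf = p ; ctr = u ; rt = q ; lf-hue = up ; rt-hue = uq } ∷ Cs F
    ; Ds = Ds F
    ; R  = R′
    ; K  = K′
    ; all-verts = ↭-trans
        (↭-solve 4 (λ t cs ds r → (t ⊕ cs) ⊕ (ds ⊕ r) ≗ cs ⊕ (ds ⊕ (t ⊕ r))) ↭-refl
          (p ∷ u ∷ q ∷ []) cs ds R′)
        (↭-trans (++⁺ˡ cs (++⁺ˡ ds (↭-sym R↭))) (all-verts F))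
    ; all-hues = ↭-trans
        (↭-solve 4 (λ t cs ds r → (t ⊕ cs) ⊕ (ds ⊕ r) ≗ cs ⊕ (ds ⊕ (t ⊕ r))) ↭-refl
          (c ∷ []) (map Cherry.hue (Cs F)) (map Claw.hue (Ds F)) K′)
        (↭-trans (++⁺ˡ (map Cherry.hue (Cs F)) (++⁺ˡ (map Claw.hue (Ds F)) (↭-sym K↭))) (all-hues F))
    }
    where
    cs = concatMap Cherry.verts (Cs F)
    ds = concatMap Claw.verts (Ds F)

  -- Three releases lose at most 3 and the new cherry gains 5. The surplus of 2 leaves room for one
  -- further demotion, which `claw-leaf-cherry` needs.
  pool-cherry : ∀ F {p u q c} → p ∈ pool F → u ∈ pool F → q ∈ pool F → p ≢ u → p ≢ q → u ≢ q →
    c ∈ K F → colour u p ≡ c → colour u q ≡ c → ∃[ G ] 2 + value F ≤ value G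
  pool-cherry F p∈ u∈ q∈ p≢u p≢q u≢q c∈K up uq
    with F₁ , p∈₁ , R₁ , pool₁ , refl , v₁ ← release F p∈
    with F₂ , u∈₂ , R₂ , pool₂ , refl , v₂ ← release F₁ (pool₁ u∈)
    with F₃ , q∈₃ , R₃ , pool₃ , refl , v₃ ← release F₂ (pool₂ (pool₁ q∈))
    with R′ , R↭ ← extract₃ (R₃ (R₂ p∈₁)) (R₃ u∈₂) q∈₃ p≢u p≢q u≢q
    with K′ , K↭ ← extract c∈K
    = add-cherry F₃ R↭ K↭ up uq ,
      ≤-trans (s≤s (s≤s (≤-trans v₁ (s≤s (≤-trans v₂ (s≤s v₃))))))
        (≤-reflexive (solve 2 (λ c d → con 5 :+ (con 5 :* c :+ d) := con 5 :* (con 1 :+ c) :+ d) refl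
          (length (Cs F₃)) (6 * length (Ds F₃))))
    where open +-*-Solver

  survives : ∀ F {D Ds′ q} → Ds F ↭ D ∷ Ds′ → ∀ x → q ≢ Claw.tip D → q ∈ pool F → q ∈ map Claw.tip Ds′ ++ x ∷ R F
  survives F {Ds′ = Ds′} Ds↭ x q≢tip q∈ with ∈-++⁻ (map Claw.tip (Ds F)) q∈
  ... | inj₂ i = ∈-++⁺ʳ (map Claw.tip Ds′) (there i)
  ... | inj₁ i = ∈-++⁺ˡ (∈-tail (∈-resp-↭ (map⁺ Claw.tip Ds↭) i) q≢tip)

  -- Demoting `D` frees its leaf `x` at a loss of 1, and `x` then becomes the centre of a cherry by
  -- `pool-cherry`. The vertices `p` and `q` must avoid the tip of `D`, which may be a leaf of the
  -- demoted star.
  claw-leaf-cherry : ∀ F {D} → D ∈ Ds F → ∀ C {x p q c} → Cherry.hue C ≡ Claw.hue D →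
    x ∷ Cherry.verts C ↭ Claw.verts D → p ∈ pool F → q ∈ pool F → p ≢ Claw.tip D → q ≢ Claw.tip D →
    p ≢ x → p ≢ q → x ≢ q → c ∈ K F → colour x p ≡ c → colour x q ≡ c → ∃[ G ] value F < value G
  claw-leaf-cherry F {D} D∈ C {x} h v p∈ q∈ p≢tip q≢tip p≢x p≢q x≢q c∈K xp xq
    with Ds′ , Ds↭ ← extract D∈
    with G , v′ ← pool-cherry (demote F Ds↭ C x h v) (survives F Ds↭ x p≢tip p∈) (∈-++⁺ʳ (map Claw.tip Ds′) (here refl)) (survives F Ds↭ x q≢tip q∈)
                    p≢x p≢q x≢q c∈K xp xq
    = G , ≤-trans (≤-reflexive (cong suc (demote-value F Ds↭ C x h v))) v′

  -- The cherry `C` is dissolved, losing 5, and `x` becomes the centre of a new claw, gaining 6. The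
  -- leaves come from `R` because releasing even one tip could consume the net gain of 1.
  cherry-leaf-claw : ∀ F {C} → C ∈ Cs F → ∀ {x y z p q t c} → Cherry.verts C ↭ x ∷ y ∷ z ∷ [] →
    p ∈ R F → q ∈ R F → t ∈ R F → p ≢ q → p ≢ t → q ≢ t → c ∈ K F →
    colour x p ≡ c → colour x q ≡ c → colour x t ≡ c → ∃[ G ] value F < value G
  cherry-leaf-claw F {C} C∈ {x} {y} {z} {p} {q} {t} {c} v p∈ q∈ t∈ p≢q p≢t q≢t c∈K xp xq xt
    with Cs′ , Cs↭ ← extract C∈
    with R′ , R↭ ← extract₃ p∈ q∈ t∈ p≢q p≢t q≢t
    with K′ , K↭ ← extract c∈K
    = record
    { Cs = Cs′
    ; Ds = record { cherry = record { hue = c ; lf = p ; ctr = x ; rt = q ; lf-hue = xp ; rt-hue = xq } ; tip = t ; tip-hue = xt } ∷ Ds F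
    ; R  = y ∷ z ∷ R′
    ; K  = Cherry.hue C ∷ K′
    ; all-verts = ↭-trans
        (↭-solve 8 (λ cs ds r x yz p q t → cs ⊕ (((t ⊕ (p ⊕ (x ⊕ q))) ⊕ ds) ⊕ (yz ⊕ r)) ≗
                                         ((x ⊕ yz) ⊕ cs) ⊕ (ds ⊕ (p ⊕ (q ⊕ (t ⊕ r))))) ↭-refl
          (concatMap Cherry.verts Cs′) ds R′ (x ∷ []) (y ∷ z ∷ []) (p ∷ []) (q ∷ []) (t ∷ []))
        (↭-trans (++⁺ (↭-trans (++⁺ʳ _ (↭-sym v)) (↭-sym (concatMap-↭ Cherry.verts Cs↭))) (++⁺ˡ ds (↭-sym R↭))) (all-verts F))
    ; all-hues = ↭-trans
        (↭-solve 5 (λ cs ds k h c → cs ⊕ ((c ⊕ ds) ⊕ (h ⊕ k)) ≗ (h ⊕ cs) ⊕ (ds ⊕ (c ⊕ k))) ↭-refl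
          (map Cherry.hue Cs′) (map Claw.hue (Ds F)) K′ (Cherry.hue C ∷ []) (c ∷ []))
        (↭-trans (++⁺ (↭-sym (map⁺ Cherry.hue Cs↭)) (++⁺ˡ (map Claw.hue (Ds F)) (↭-sym K↭))) (all-hues F))
    } , ≤-trans (≤-reflexive (cong (λ m → suc (5 * m + 6 * length (Ds F))) (↭-length Cs↭)))
          (≤-reflexive (solve 2 (λ c d → con 1 :+ (con 5 :* (con 1 :+ c) :+ con 6 :* d) := con 5 :* c :+ con 6 :* (con 1 :+ d)) refl
            (length Cs′) (length (Ds F))))
    where
    open +-*-Solver
    ds = concatMap Claw.verts (Ds F)

-- Vertex lists read as cycles

module _ {A : Set} where

  -- Past the end the value is d; with d the head of xs, the list is read cyclically one step further.
  at : A → List A → ℕ → A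
  at d []       _       = d
  at d (x ∷ xs) zero    = x
  at d (x ∷ xs) (suc i) = at d xs i

  drop-second : ∀ {a b : A} {xs} → Unique (a ∷ b ∷ xs) → Unique (a ∷ xs)
  drop-second ((_ ∷ a∉) ∷ (_ ∷ u)) = a∉ ∷ u

  at-∈ : ∀ d xs {i} → i < length xs → at d xs i ∈ xs
  at-∈ d (x ∷ xs) {zero}  _         = here refl
  at-∈ d (x ∷ xs) {suc i} (s≤s i<m) = there (at-∈ d xs i<m)

  at-injective : ∀ d {xs i j} → Unique xs → i < length xs → j < length xs → at d xs i ≡ at d xs j → i ≡ j
  at-injective d {x ∷ xs} {zero}  {zero}  _ _ _ _ = refl
  at-injective d {x ∷ xs} {zero}  {suc j} (x∉ ∷ _) _ (s≤s j<m) e = contradiction e (All.lookup x∉ (at-∈ d xs j<m))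
  at-injective d {x ∷ xs} {suc i} {zero}  (x∉ ∷ _) (s≤s i<m) _ e = contradiction (sym e) (All.lookup x∉ (at-∈ d xs i<m))
  at-injective d {x ∷ xs} {suc i} {suc j} (_ ∷ u) (s≤s i<m) (s≤s j<m) e = cong suc (at-injective d u i<m j<m e)

  at-++ : ∀ d xs ys j → at d (xs ++ ys) (j + length xs) ≡ at d ys j
  at-++ d []       ys j = cong (at d ys) (+-identityʳ j)
  at-++ d (x ∷ xs) ys j = trans (cong (at d (x ∷ xs ++ ys)) (+-suc j (length xs))) (at-++ d xs ys j)

  at-length : ∀ d xs → at d xs (length xs) ≡ d
  at-length d []       = refl
  at-length d (x ∷ xs) = at-length d xs

  module _ {P : Rel A 0ℓ} where

    linked-at : ∀ d xs {i} → Linked P (xs ++ d ∷ []) → i < length xs → P (at d xs i) (at d xs (suc i))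
    linked-at d (x ∷ [])     {zero}  (p ∷ _) _         = p
    linked-at d (x ∷ y ∷ xs) {zero}  (p ∷ _) _         = p
    linked-at d (x ∷ [])     {suc i} _       (s≤s ())
    linked-at d (x ∷ y ∷ xs) {suc i} (_ ∷ l) (s≤s i<m) = linked-at d (y ∷ xs) l i<m

    -- The two paths share `x`, so no new edge has to be checked.
    linked-join : ∀ xs {x ys} → Linked P (xs ++ x ∷ []) → Linked P (x ∷ ys) → Linked P (xs ++ x ∷ ys)
    linked-join []            _        l = l
    linked-join (y ∷ [])      (p ∷ _)  l = p ∷ l
    linked-join (y ∷ z ∷ xs)  (p ∷ l′) l = p ∷ linked-join (z ∷ xs) l′ l

    linked-universal : (∀ x y → P x y) → ∀ xs → Linked P xs
    linked-universal p []           = []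
    linked-universal p (x ∷ [])     = [-]
    linked-universal p (x ∷ y ∷ xs) = p x y ∷ linked-universal p (y ∷ xs)

  length-concatMap : ∀ {B : Set} (f : A → List B) m → (∀ x → length (f x) ≡ m) →
                     ∀ xs → length (concatMap f xs) ≡ m * length xs
  length-concatMap f m eq []       = sym (*-zeroʳ m)
  length-concatMap f m eq (x ∷ xs) = trans (length-++ (f x))
    (trans (cong₂ _+_ (eq x) (length-concatMap f m eq xs)) (sym (*-suc m (length xs))))

-- Hamilton cycles on which no colour occurs exactly once

module GoodCycle {n r : ℕ} (n≥3 : 3 ≤ n) (χ : Colouring n r) (unique : UniqueColouring (cycle n n≥3) χ) where
  open Colouring χ

  -- Asking for two consecutive edges matches the path through a star, and the property survives
  -- adding vertices at either end.
  Doubled : Fin r → List (Fin n) → Set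
  Doubled c xs = ∃₂ λ as bs → ∃₂ λ a b → ∃[ d ] xs ≡ as ++ a ∷ b ∷ d ∷ bs × colour a b ≡ c × colour b d ≡ c

  doubled-++ʳ : ∀ {c} xs {ys} → Doubled c ys → Doubled c (xs ++ ys)
  doubled-++ʳ xs (as , bs , a , b , d , refl , e) = xs ++ as , bs , a , b , d , sym (++-assoc xs as _) , e

  doubled-++ˡ : ∀ {c xs} ys → Doubled c xs → Doubled c (xs ++ ys)
  doubled-++ˡ ys (as , bs , a , b , d , refl , e) = as , bs ++ ys , a , b , d , ++-assoc as _ ys , e

  -- Reading the list cyclically embeds the cycle. A colour occurring once on it lies in `S`, since
  -- all edges do, and is then repeated on two adjacent edges.
  no-good-cycle : ∀ z zs → z ∷ zs ↭ allFin n → (S : List (Fin r)) →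
    Linked (λ u v → colour u v ∈ S) (z ∷ zs ++ z ∷ []) → (∀ {c} → c ∈ S → Doubled c (z ∷ zs)) → ⊥
  no-good-cycle z zs xs↭ S linked has = conclude (unique φ λ {i} {j} e → toℕ-injective
    (at-injective z (Unique-resp-↭ (↭-sym xs↭) (Unique.allFin⁺ n)) (below i) (below j) e))
    where
    xs = z ∷ zs

    φ : Fin n → Fin n
    φ i = at z xs (toℕ i)

    length-xs : length xs ≡ n
    length-xs = trans (↭-length xs↭) (length-tabulate id)

    below : ∀ i → toℕ i < length xs
    below i = subst (toℕ i <_) (sym length-xs) (toℕ<n i)

    next : ∀ {u v} → Next u v → colour (φ u) (φ v) ∈ S
    next {u} (inj₁ e) = subst (λ j → colour (φ u) (at z xs j) ∈ S) (sym e) (linked-at z xs linked (below u))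
    -- For the closing edge, position `length xs` is past the end, where `at` returns the default
    -- `z`, the first vertex.
    next {u} {v} (inj₂ (e , e₀)) = subst (λ w → colour (φ u) w ∈ S)
      (trans (trans (cong (at z xs) (trans e (sym length-xs))) (at-length z xs)) (cong (at z xs) (sym e₀)))
      (linked-at z xs linked (below u))

    hue∈ : ∀ {u v} → Next u v ⊎ Next v u → colour (φ u) (φ v) ∈ S
    hue∈ (inj₁ a) = next a
    hue∈ (inj₂ a) = subst (_∈ S) (colour-sym _ _) (next a)

    twice : ∀ c {u v} → (∀ {i j} → Next i j ⊎ Next j i → colour (φ i) (φ j) ≡ c → SameEdge u v i j) → Doubled c xs → ⊥
    twice c only (as , bs , a , b , d , e , ab , bd) = clash (edge 0<3 1<3 ab) (edge 1<3 2<3 bd)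
      where
      0<3 : 0 < 3
      0<3 = s≤s z≤n
      1<3 : 1 < 3
      1<3 = s≤s (s≤s z≤n)
      2<3 : 2 < 3
      2<3 = s≤s (s≤s (s≤s z≤n))

      bound : ∀ {j} → j < 3 → j + length as < n
      bound {j} j<3 = subst (j + length as <_) length-xs (subst (λ ys → j + length as < length ys) (sym e)
        (subst (j + length as <_) (sym (trans (length-++ as) (+-comm (length as) _)))
          (+-monoˡ-< (length as) (≤-trans j<3 (m≤m+n 3 (length bs))))))

      ix : ∀ {j} → j < 3 → Fin n
      ix j<3 = fromℕ< (bound j<3)

      φ-ix : ∀ {j} (j<3 : j < 3) → φ (ix j<3) ≡ at z (a ∷ b ∷ d ∷ bs) j
      φ-ix {j} j<3 = trans (cong (at z xs) (toℕ-fromℕ< (bound j<3)))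
        (trans (cong (λ ys → at z ys (j + length as)) e) (at-++ z as _ j))

      ix-injective : ∀ {i j} (i<3 : i < 3) (j<3 : j < 3) → ix i<3 ≡ ix j<3 → i ≡ j
      ix-injective i<3 j<3 eq = +-cancelʳ-≡ (length as) _ _
        (trans (sym (toℕ-fromℕ< (bound i<3))) (trans (cong toℕ eq) (toℕ-fromℕ< (bound j<3))))

      edge : ∀ {j} (j<3 : j < 3) (j+1<3 : suc j < 3) → colour (at z (a ∷ b ∷ d ∷ bs) j) (at z (a ∷ b ∷ d ∷ bs) (suc j)) ≡ c →
             SameEdge _ _ (ix j<3) (ix j+1<3)
      edge j<3 j+1<3 eq = only
        (inj₁ (inj₁ (trans (toℕ-fromℕ< (bound j+1<3)) (cong suc (sym (toℕ-fromℕ< (bound j<3)))))))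
        (trans (cong₂ colour (φ-ix j<3) (φ-ix j+1<3)) eq)

      -- If both edges are the edge from `u` to `v`, each choice of orientations makes two of the
      -- three positions coincide.
      clash : ∀ {u v} → SameEdge u v (ix 0<3) (ix 1<3) → SameEdge u v (ix 1<3) (ix 2<3) → ⊥
      clash (inj₁ (e₁ , e₂)) (inj₁ (e₃ , e₄)) with () ← ix-injective 0<3 1<3 (trans e₁ (sym e₃))
      clash (inj₁ (e₁ , e₂)) (inj₂ (e₃ , e₄)) with () ← ix-injective 0<3 2<3 (trans e₁ (sym e₄))
      clash (inj₂ (e₁ , e₂)) (inj₁ (e₃ , e₄)) with () ← ix-injective 0<3 2<3 (trans e₁ (sym e₄))
      clash (inj₂ (e₁ , e₂)) (inj₂ (e₃ , e₄)) with () ← ix-injective 0<3 1<3 (trans e₁ (sym e₃))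

    conclude : SomeColourOnce (cycle n n≥3) χ φ → ⊥
    conclude (c , u , v , adj , refl , only) = twice c (λ {i} {j} → only i j) (has (hue∈ adj))

module _ {A : Set} where

  attach-claw-↭ : (ds t a l v b : List A) → ds ++ (t ++ a) ++ l ++ v ++ b ↭ (t ++ l ++ ds) ++ (v ++ a) ++ b
  attach-claw-↭ = ↭-solve 6 (λ ds t a l v b → ds ⊕ ((t ⊕ a) ⊕ (l ⊕ (v ⊕ b))) ≗ (t ⊕ (l ⊕ ds)) ⊕ ((v ⊕ a) ⊕ b)) ↭-refl

  attach-cherry-↭ : (cs ds a l v b : List A) → cs ++ ds ++ a ++ l ++ v ++ b ↭ (l ++ cs) ++ ds ++ (v ++ a) ++ b
  attach-cherry-↭ = ↭-solve 6 (λ cs ds a l v b → cs ⊕ (ds ⊕ (a ⊕ (l ⊕ (v ⊕ b)))) ≗ (l ⊕ cs) ⊕ (ds ⊕ ((v ⊕ a) ⊕ b))) ↭-refl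

-- Bad degrees in a configuration of maximal value

module MaximalConfig {n r : ℕ} (χ : Colouring n r) (F : Configurations.Config χ)
  (maximal : (G : Configurations.Config χ) → ¬ Configurations.Config.value F < Configurations.Config.value G) where
  open Colouring χ
  open Configurations χ
  open Config F

  S : List (Fin r)
  S = map Cherry.hue Cs ++ map Claw.hue Ds

  k : ℕ
  k = length K

  Bad : Rel (Fin n) 0ℓ
  Bad u v = colour u v ∉ S

  bad? : Decidable Bad
  bad? u v = ¬? (_∈?_ Fin._≟_ (colour u v) S)

  open Insertion Bad bad? public

  bad-sym : Symmetric Bad
  bad-sym {u} {v} ¬∈ = ¬∈ ∘ subst (_∈ S) (colour-sym v u)

  good→∈ : ∀ {u v} → Good u v → colour u v ∈ S
  good→∈ {u} {v} = decidable-stable (_∈?_ Fin._≟_ (colour u v) S)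

  ∈→good : ∀ {u v} → colour u v ∈ S → Good u v
  ∈→good i ¬i = ¬i i

  bad→∈K : ∀ {u v} → Bad u v → colour u v ∈ K
  bad→∈K {u} {v} b with ∈-++⁻ (map Cherry.hue Cs) (∈-resp-↭ (↭-sym all-hues) (∈-allFin (colour u v)))
  ... | inj₁ i = contradiction (∈-++⁺ˡ i) b
  ... | inj₂ i with ∈-++⁻ (map Claw.hue Ds) i
  ...   | inj₁ j = contradiction (∈-++⁺ʳ (map Cherry.hue Cs) j) b
  ...   | inj₂ j = j

  cherry-hue∈ : ∀ {C} → C ∈ Cs → Cherry.hue C ∈ S
  cherry-hue∈ C∈ = ∈-++⁺ˡ (∈-map⁺ Cherry.hue C∈)

  claw-hue∈ : ∀ {D} → D ∈ Ds → Claw.hue D ∈ S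
  claw-hue∈ D∈ = ∈-++⁺ʳ (map Cherry.hue Cs) (∈-map⁺ Claw.hue D∈)

  bad⊆ : ∀ {v p} W → p ∈ filter (bad? v) W → p ∈ W × colour v p ∈ K
  bad⊆ {v} W p∈ = map₂ bad→∈K (∈-filter⁻ (bad? v) {xs = W} p∈)

  -- Two bad edges of one colour from `v` into the pool would form a new cherry, so `colour v` is
  -- injective on the bad neighbours, with values in `K`.
  pool-degree : ∀ {v} → v ∈ pool → ∀ W → Unique (v ∷ W) → All (_∈ pool) W → bad v W ≤ k
  pool-degree {v} v∈ W (v∉W ∷ uniq) W⊆ =
    injective-bound Fin._≟_ (colour v) (Unique.filter⁺ (bad? v) uniq) (proj₂ ∘ bad⊆ W)
      λ {p} {q} p∈ q∈ p≢q vq≡vp →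
        let p∈W , c∈K = bad⊆ W p∈ ; q∈W , _ = bad⊆ W q∈
            G , lt = pool-cherry F (All.lookup W⊆ p∈W) v∈ (All.lookup W⊆ q∈W)
                       (≢-sym (All.lookup v∉W p∈W)) p≢q (All.lookup v∉W q∈W) c∈K refl vq≡vp
        in maximal G (<-trans (n<1+n _) lt)

  claw-leaf∉pool : ∀ {D} → D ∈ Ds → ∀ {p} → p ∈ pool → p ≢ Claw.lf D × p ≢ Claw.rt D
  claw-leaf∉pool {D} D∈ p∈ with Ds′ , Ds↭ ← extract D∈ =
    separate (Unique-resp-↭ (↭-trans (↭-sym all-verts) (↭-trans
      (++⁺ˡ (concatMap Cherry.verts Cs) (++⁺ʳ R (concatMap-↭ Claw.verts Ds↭)))
      (↭-solve 5 (λ cs t ls ds r → cs ⊕ (((t ⊕ ls) ⊕ ds) ⊕ r) ≗ ls ⊕ ((t ⊕ ds) ⊕ (r ⊕ cs))) ↭-refl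
        (concatMap Cherry.verts Cs) (tip ∷ []) (Cherry.verts (Claw.cherry D)) (concatMap Claw.verts Ds′) R)))
      (Unique.allFin⁺ n))
    ([ (λ i → ∈-++⁺ˡ (tips⊆ Ds′ (∈-resp-↭ (map⁺ Claw.tip Ds↭) i)))
     , (λ i → ∈-++⁺ʳ (tip ∷ concatMap Claw.verts Ds′) (∈-++⁺ˡ i)) ]′ (∈-++⁻ (map Claw.tip Ds) p∈))
    where
    open Claw D using (tip)

    tips : ∀ Ds {p} → p ∈ map Claw.tip Ds → p ∈ concatMap Claw.verts Ds
    tips (D ∷ Ds) (here refl) = here refl
    tips (D ∷ Ds) (there i)   = ∈-++⁺ʳ (Claw.verts D) (tips Ds i)

    tips⊆ : ∀ Ds {p} → p ∈ tip ∷ map Claw.tip Ds → p ∈ tip ∷ concatMap Claw.verts Ds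
    tips⊆ Ds (here refl) = here refl
    tips⊆ Ds (there i)   = there (tips Ds i)

    separate : ∀ {p a b d W} → Unique (a ∷ b ∷ d ∷ W) → p ∈ W → p ≢ a × p ≢ d
    separate ((_ ∷ _ ∷ a∉) ∷ _ ∷ (d∉ ∷ _)) p∈ = ≢-sym (All.lookup a∉ p∈) , ≢-sym (All.lookup d∉ p∈)

  claw-leaf-pair : ∀ {D} → D ∈ Ds → ∀ C {x} → Cherry.hue C ≡ Claw.hue D → x ∷ Cherry.verts C ↭ Claw.verts D →
    (∀ {p} → p ∈ pool → p ≢ x) → ∀ {p q} → p ∈ pool → q ∈ pool → p ≢ Claw.tip D → q ≢ Claw.tip D → p ≢ q →
    colour x p ∈ K → ¬ colour x q ≡ colour x p
  claw-leaf-pair D∈ C h v ≢x p∈ q∈ p≢tip q≢tip p≢q c∈K xq≡xp =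
    let G , lt = claw-leaf-cherry F D∈ C h v p∈ q∈ p≢tip q≢tip (≢x p∈) p≢q (≢-sym (≢x q∈)) c∈K refl xq≡xp
    in maximal G lt

  -- The claw is demoted to the cherry on `lf` and `tip`, which frees `rt` as a new centre. The tip
  -- of `D` stays in use there, hence `W` must not contain it.
  claw-rt-degree : ∀ {D} → D ∈ Ds → ∀ W → Unique (Claw.tip D ∷ W) → All (_∈ pool) W → bad (Claw.rt D) W ≤ k
  claw-rt-degree {D} D∈ W (tip∉W ∷ uniq) W⊆ =
    injective-bound Fin._≟_ (colour rt) (Unique.filter⁺ (bad? rt) uniq) (proj₂ ∘ bad⊆ W)
      λ p∈ q∈ p≢q → let p∈W , c∈K = bad⊆ W p∈ ; q∈W , _ = bad⊆ W q∈ in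
        claw-leaf-pair D∈
          (record { hue = hue ; lf = lf ; ctr = ctr ; rt = tip ; lf-hue = lf-hue ; rt-hue = tip-hue }) refl
          (↭-solve 4 (λ x a b t → x ⊕ (a ⊕ (b ⊕ t)) ≗ t ⊕ (a ⊕ (b ⊕ x))) ↭-refl (rt ∷ []) (lf ∷ []) (ctr ∷ []) (tip ∷ []))
          (λ i → proj₂ (claw-leaf∉pool D∈ i)) (All.lookup W⊆ p∈W) (All.lookup W⊆ q∈W)
          (≢-sym (All.lookup tip∉W p∈W)) (≢-sym (All.lookup tip∉W q∈W)) p≢q c∈K
    where open Claw D

  -- Here `W` may contain the tip of `D`, which the demoted claw occupies. Among three bad edges of
  -- one colour two still avoid it, so each colour occurs at most twice.
  claw-lf-degree : ∀ {D} → D ∈ Ds → ∀ W → Unique W → All (_∈ pool) W → bad (Claw.lf D) W ≤ 2 * k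
  claw-lf-degree {D} D∈ W uniq W⊆ =
    two-to-one-bound Fin._≟_ (colour lf) (Unique.filter⁺ (bad? lf) uniq) (proj₂ ∘ bad⊆ W) triple
    where
    open Claw D
    pair : ∀ {p q} → p ∈ filter (bad? lf) W → q ∈ filter (bad? lf) W → p ≢ tip → q ≢ tip → p ≢ q →
           ¬ colour lf q ≡ colour lf p
    pair p∈ q∈ p≢tip q≢tip p≢q = let p∈W , c∈K = bad⊆ W p∈ ; q∈W , _ = bad⊆ W q∈ in
      claw-leaf-pair D∈
        (record { hue = hue ; lf = tip ; ctr = ctr ; rt = rt ; lf-hue = tip-hue ; rt-hue = rt-hue }) refl
        (↭-swap lf tip ↭-refl)
        (λ i → proj₁ (claw-leaf∉pool D∈ i)) (All.lookup W⊆ p∈W) (All.lookup W⊆ q∈W) p≢tip q≢tip p≢q c∈K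

    triple : ∀ {p q t} → p ∈ filter (bad? lf) W → q ∈ filter (bad? lf) W → t ∈ filter (bad? lf) W →
             p ≢ q → p ≢ t → q ≢ t → colour lf q ≡ colour lf p → colour lf t ≡ colour lf p → ⊥
    triple {p} {q} p∈ q∈ t∈ p≢q p≢t q≢t eq et with p Fin.≟ tip | q Fin.≟ tip
    ... | yes refl | _       = pair q∈ t∈ (≢-sym p≢q) (≢-sym p≢t) q≢t (trans et (sym eq))
    ... | no p≢tip | yes refl = pair p∈ t∈ p≢tip (≢-sym q≢t) p≢t et
    ... | no p≢tip | no q≢tip = pair p∈ q∈ p≢tip q≢tip p≢q eq

  -- Three bad edges of one colour into `R` would allow the exchange of `cherry-leaf-claw`.
  cherry-leaf-degree : ∀ {C} → C ∈ Cs → ∀ {x y z} → Cherry.verts C ↭ x ∷ y ∷ z ∷ [] →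
    ∀ W → Unique W → All (_∈ R) W → bad x W ≤ 2 * k
  cherry-leaf-degree C∈ {x} v W uniq W⊆ =
    two-to-one-bound Fin._≟_ (colour x) (Unique.filter⁺ (bad? x) uniq) (proj₂ ∘ bad⊆ W)
      λ p∈ q∈ t∈ p≢q p≢t q≢t eq et →
        let p∈W , c∈K = bad⊆ W p∈ ; q∈W , _ = bad⊆ W q∈ ; t∈W , _ = bad⊆ W t∈
            G , lt = cherry-leaf-claw F C∈ v (All.lookup W⊆ p∈W) (All.lookup W⊆ q∈W) (All.lookup W⊆ t∈W)
                       p≢q p≢t q≢t c∈K refl eq et
        in maximal G lt

  cherry-lf-degree : ∀ {C} → C ∈ Cs → ∀ W → Unique W → All (_∈ R) W → bad (Cherry.lf C) W ≤ 2 * k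
  cherry-lf-degree C∈ = cherry-leaf-degree C∈ ↭-refl

  cherry-rt-degree : ∀ {C} → C ∈ Cs → ∀ W → Unique W → All (_∈ R) W → bad (Cherry.rt C) W ≤ 2 * k
  cherry-rt-degree {C} C∈ = cherry-leaf-degree C∈ (reverse₃ (Cherry.lf C) (Cherry.ctr C) (Cherry.rt C))
    where
    reverse₃ : ∀ (a b d : Fin n) → a ∷ b ∷ d ∷ [] ↭ d ∷ b ∷ a ∷ []
    reverse₃ a b d = ↭-trans (↭-swap a b ↭-refl) (↭-trans (↭-prep b (↭-swap a d ↭-refl)) (↭-swap b d ↭-refl))

  common-neighbour : ∀ x y A → bad x A + bad y A < length A →
    ∃₂ λ v A′ → A ↭ v ∷ A′ × Good x v × Good y v
  common-neighbour x y A lt =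
    let v , v∈ , gx , gy = pick₂ (bad? x) (bad? y) A lt
        A′ , A↭ = extract v∈
    in v , A′ , A↭ , gx , gy

  R-large : 4 * r ≤ n → 4 * k + length Cs ≤ length R
  R-large 4r≤n = +-cancelˡ-≤ (3 * a + 4 * b) _ _ (begin
    3 * a + 4 * b + (4 * k + a) ≡⟨ solve 3 (λ a b k → con 3 :* a :+ con 4 :* b :+ (con 4 :* k :+ a) := con 4 :* (a :+ (b :+ k))) refl a b k ⟩
    4 * (a + (b + k))           ≡⟨ cong (4 *_) (hue-count F) ⟩
    4 * r                       ≤⟨ 4r≤n ⟩
    n                           ≡⟨ verts ⟨
    3 * a + (4 * b + length R)  ≡⟨ +-assoc (3 * a) (4 * b) (length R) ⟨
    3 * a + 4 * b + length R    ∎)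
    where
    open ≤-Reasoning
    open +-*-Solver
    a = length Cs
    b = length Ds

    verts : 3 * a + (4 * b + length R) ≡ n
    verts = trans (cong₂ _+_ (sym (length-concatMap Cherry.verts 3 (λ _ → refl) Cs))
        (trans (cong (_+ length R) (sym (length-concatMap Claw.verts 4 (λ _ → refl) Ds))) (sym (length-++ (concatMap Claw.verts Ds)))))
      (trans (sym (length-++ (concatMap Cherry.verts Cs))) (trans (↭-length all-verts) (length-tabulate id)))

  -- Assembling the Hamilton cycle

  module Assembly (n≥3 : 3 ≤ n) (4r≤n : 4 * r ≤ n) (unique : UniqueColouring (cycle n n≥3) χ) where
    open GoodCycle n≥3 χ unique
    open +-*-Solver

    2k+k<4k : 1 ≤ k → 2 * k + k < 4 * k
    2k+k<4k k≥1 = <-≤-trans (m<m+n (2 * k + k) k≥1)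
      (≤-reflexive (solve 1 (λ k → con 2 :* k :+ k :+ k := con 4 :* k) refl k))

    2k+2k<4k+ : ∀ m → 2 * k + 2 * k < 4 * k + suc m
    2k+2k<4k+ m = ≤-<-trans (≤-reflexive (solve 1 (λ k → con 2 :* k :+ con 2 :* k := con 4 :* k) refl k)) (m<m+n (4 * k) z<s)

    lf-ctr-good : ∀ {C} → C ∈ Cs → Good (Cherry.lf C) (Cherry.ctr C)
    lf-ctr-good {C} C∈ = ∈→good (subst (_∈ S) (sym (trans (colour-sym _ _) (Cherry.lf-hue C))) (cherry-hue∈ C∈))

    ctr-rt-good : ∀ {C} → C ∈ Cs → Good (Cherry.ctr C) (Cherry.rt C)
    ctr-rt-good {C} C∈ = ∈→good (subst (_∈ S) (sym (Cherry.rt-hue C)) (cherry-hue∈ C∈))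

    claw-lf-ctr-good : ∀ {D} → D ∈ Ds → Good (Claw.lf D) (Claw.ctr D)
    claw-lf-ctr-good {D} D∈ = ∈→good (subst (_∈ S) (sym (trans (colour-sym _ _) (Claw.lf-hue D))) (claw-hue∈ D∈))

    claw-ctr-rt-good : ∀ {D} → D ∈ Ds → Good (Claw.ctr D) (Claw.rt D)
    claw-ctr-rt-good {D} D∈ = ∈→good (subst (_∈ S) (sym (Claw.rt-hue D)) (claw-hue∈ D∈))

    doubled-cherry : ∀ C xs → Doubled (Cherry.hue C) (Cherry.verts C ++ xs)
    doubled-cherry C xs = [] , xs , lf , ctr , rt , refl , trans (colour-sym lf ctr) lf-hue , rt-hue
      where open Cherry C

    linked-S : ∀ {xs} → Linked Good xs → Linked (λ u v → colour u v ∈ S) xs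
    linked-S = Linked.map good→∈

    module _ (K≡[] : K ≡ []) where

      all-pieces : List (Fin n)
      all-pieces = concatMap Cherry.verts Cs ++ concatMap Claw.verts Ds ++ R

      doubled-hue : ∀ {c} → c ∈ S → Doubled c all-pieces
      doubled-hue c∈ with ∈-++⁻ (map Cherry.hue Cs) c∈
      ... | inj₁ i = doubled-++ˡ _ (cherries Cs i)
        where
        cherries : ∀ Cs {c} → c ∈ map Cherry.hue Cs → Doubled c (concatMap Cherry.verts Cs)
        cherries (C ∷ Cs) (here refl) = doubled-cherry C (concatMap Cherry.verts Cs)
        cherries (C ∷ Cs) (there i)   = doubled-++ʳ (Cherry.verts C) (cherries Cs i)
      ... | inj₂ i = doubled-++ʳ (concatMap Cherry.verts Cs) (doubled-++ˡ R (claws Ds i))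
        where
        claws : ∀ Ds {c} → c ∈ map Claw.hue Ds → Doubled c (concatMap Claw.verts Ds)
        claws (D ∷ Ds) (here refl) = doubled-++ʳ (Claw.tip D ∷ []) (doubled-cherry (Claw.cherry D) (concatMap Claw.verts Ds))
        claws (D ∷ Ds) (there i)   = doubled-++ʳ (Claw.verts D) (claws Ds i)

      all-hues-used : ⊥
      all-hues-used = close all-pieces all-verts doubled-hue
        where
        good : ∀ u v → Good u v
        good u v b with () ← subst (colour u v ∈_) K≡[] (bad→∈K b)

        close : ∀ xs → xs ↭ allFin n → (∀ {c} → c ∈ S → Doubled c xs) → ⊥
        close []       p _   = <⇒≢ (≤-trans (s≤s z≤n) n≥3) (trans (↭-length p) (length-tabulate id))
        close (z ∷ zs) p has = no-good-cycle z zs p S (linked-S (linked-universal good (z ∷ zs ++ z ∷ []))) has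

    module _ (k≥1 : 1 ≤ k) where

      module _ (r₀ : Fin n) (r₀∈ : r₀ ∈ pool) where

        -- The end `r₀` of the path is moved to the front of the list, and `arrange` leads from it
        -- through all of `A` back to the open end `x`.
        close-up : ∀ A x body → A ++ x ∷ body ++ r₀ ∷ [] ↭ allFin n → All (_∈ pool) A → 4 * k ≤ length A →
          bad x A ≤ 2 * k → Linked Good (x ∷ body ++ r₀ ∷ []) → (∀ {c} → c ∈ S → Doubled c (x ∷ body)) → ⊥
        close-up A x body total A⊆ big bad-x linked has =
          conclude (arrange bad-sym (_∈ pool) k k≥1 (λ v∈ → pool-degree v∈) r₀ x A r₀∷A-unique (r₀∈ ∷ A⊆) big bad-x)
          where
          rotate : A ++ x ∷ body ++ r₀ ∷ [] ↭ r₀ ∷ A ++ x ∷ body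
          rotate = ↭-trans (++⁺ˡ A (++-comm (x ∷ body) (r₀ ∷ []))) (shift r₀ A (x ∷ body))

          r₀∷A-unique : Unique (r₀ ∷ A)
          r₀∷A-unique = Unique-resp-⊆ (refl ∷ Sublist.++⁺ʳ (x ∷ body) ⊆-refl)
            (Unique-resp-↭ (↭-trans (↭-sym total) rotate) (Unique.allFin⁺ n))

          conclude : ∃ (λ zs → zs ↭ A × Linked Good (r₀ ∷ zs ++ x ∷ [])) → ⊥
          conclude (zs , zs↭ , linked′) = no-good-cycle r₀ (zs ++ x ∷ body)
            (↭-trans (↭-prep r₀ (++⁺ʳ (x ∷ body) zs↭)) (↭-trans (↭-sym rotate) total)) S
            (linked-S (subst (Linked Good) (cong (r₀ ∷_) (sym (++-assoc zs (x ∷ body) (r₀ ∷ []))))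
              (linked-join (r₀ ∷ zs) linked′ linked)))
            (λ c∈ → doubled-++ʳ (r₀ ∷ zs) (has c∈))

        -- The tip of D joins the free vertices A only after D has been attached, so A
        -- never contains it when a neighbour of D is chosen; this leaves rt D only k
        -- bad vertices. Each claw costs one free vertex and supplies one.
        add-claws : ∀ Ds′ → All (_∈ Ds) Ds′ → ∀ A x body →
          concatMap Claw.verts Ds′ ++ A ++ x ∷ body ++ r₀ ∷ [] ↭ allFin n → All (_∈ pool) A → 4 * k ≤ length A →
          bad x A ≤ 2 * k → Linked Good (x ∷ body ++ r₀ ∷ []) →
          (∀ {c} → c ∈ S → c ∈ map Claw.hue Ds′ ⊎ Doubled c (x ∷ body)) → ⊥
        add-claws [] _ A x body total A⊆ big bad-x linked has =
          close-up A x body total A⊆ big bad-x linked λ c∈ → [ (λ ()) , id ]′ (has c∈)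
        add-claws (D ∷ Ds′) (D∈ ∷ Ds′∈) A x body total A⊆ big bad-x linked has =
          attach (common-neighbour x rt A
            (<-≤-trans (≤-<-trans (+-mono-≤ bad-x (claw-rt-degree D∈ A uniq A⊆)) (2k+k<4k k≥1)) big))
          where
          open Claw D

          uniq : Unique (tip ∷ A)
          uniq = Unique-resp-⊆
            (refl ∷ lf ∷ʳ ctr ∷ʳ rt ∷ʳ Sublist.++⁺ˡ (concatMap Claw.verts Ds′) (Sublist.++⁺ʳ (x ∷ body ++ r₀ ∷ []) ⊆-refl))
            (Unique-resp-↭ (↭-sym total) (Unique.allFin⁺ n))

          step : ∀ {c} v → c ∈ hue ∷ map Claw.hue Ds′ ⊎ Doubled c (x ∷ body) →
                 c ∈ map Claw.hue Ds′ ⊎ Doubled c (lf ∷ ctr ∷ rt ∷ v ∷ x ∷ body)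
          step v (inj₁ (here refl)) = inj₂ (doubled-cherry cherry (v ∷ x ∷ body))
          step v (inj₁ (there i))   = inj₁ i
          step v (inj₂ h)           = inj₂ (doubled-++ʳ (lf ∷ ctr ∷ rt ∷ v ∷ []) h)

          attach : ∃₂ (λ v A′ → A ↭ v ∷ A′ × Good x v × Good rt v) → ⊥
          -- The path grows on the left: `v` joins `rt` to the old end `x`, and `lf` becomes the
          -- open end. The weaker bound at `lf` suffices for an open end and tolerates the tip in
          -- the free list.
          attach (v , A′ , A↭ , g , g′) = add-claws Ds′ Ds′∈ (tip ∷ A′) lf (ctr ∷ rt ∷ v ∷ x ∷ body)
            (↭-trans (attach-claw-↭ (concatMap Claw.verts Ds′) (tip ∷ []) A′ (Cherry.verts cherry) (v ∷ []) (x ∷ body ++ r₀ ∷ []))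
              (↭-trans (++⁺ˡ (concatMap Claw.verts (D ∷ Ds′)) (++⁺ʳ (x ∷ body ++ r₀ ∷ []) (↭-sym A↭))) total))
            tipA′⊆
            (≤-trans big (≤-reflexive (↭-length A↭)))
            (claw-lf-degree D∈ (tip ∷ A′) (drop-second (Unique-resp-↭ (↭-prep tip A↭) uniq)) tipA′⊆)
            (claw-lf-ctr-good D∈ ∷ claw-ctr-rt-good D∈ ∷ g′ ∷ g ∘ bad-sym ∷ linked)
            (λ c∈ → step v (has c∈))
            where
            tipA′⊆ : All (_∈ pool) (tip ∷ A′)
            tipA′⊆ = ∈-++⁺ˡ (∈-map⁺ Claw.tip D∈) ∷ All.tail (All-resp-↭ A↭ A⊆)

        -- Cherries come first: the bound on the bad edges at their leaves covers R but
        -- not the tips of the claws.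
        add-cherries : ∀ Cs′ → All (_∈ Cs) Cs′ → ∀ Ds′ → All (_∈ Ds) Ds′ → ∀ A x body →
          concatMap Cherry.verts Cs′ ++ concatMap Claw.verts Ds′ ++ A ++ x ∷ body ++ r₀ ∷ [] ↭ allFin n →
          All (_∈ R) A → 4 * k + length Cs′ ≤ length A →
          bad x A ≤ 2 * k → Linked Good (x ∷ body ++ r₀ ∷ []) →
          (∀ {c} → c ∈ S → c ∈ map Cherry.hue Cs′ ⊎ (c ∈ map Claw.hue Ds′ ⊎ Doubled c (x ∷ body))) → ⊥
        add-cherries [] _ Ds′ Ds′∈ A x body total A⊆ big bad-x linked has =
          add-claws Ds′ Ds′∈ A x body total (All.map (∈-++⁺ʳ (map Claw.tip Ds)) A⊆)
            (≤-trans (m≤m+n _ _) big) bad-x linked λ c∈ → [ (λ ()) , id ]′ (has c∈)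
        add-cherries (C ∷ Cs′) (C∈ ∷ Cs′∈) Ds′ Ds′∈ A x body total A⊆ big bad-x linked has =
          attach (common-neighbour x rt A
            -- Both ends can have `2 * k` bad neighbours here. The extra free vertex reserved for
            -- each cherry makes the inequality strict, and `v` then uses it up.
            (<-≤-trans (≤-<-trans (+-mono-≤ bad-x (cherry-rt-degree C∈ A uniq A⊆)) (2k+2k<4k+ (length Cs′))) big))
          where
          open Cherry C

          uniq : Unique A
          uniq = Unique-resp-⊆
            (lf ∷ʳ ctr ∷ʳ rt ∷ʳ Sublist.++⁺ˡ (concatMap Cherry.verts Cs′) (Sublist.++⁺ˡ (concatMap Claw.verts Ds′) (Sublist.++⁺ʳ (x ∷ body ++ r₀ ∷ []) ⊆-refl)))
            (Unique-resp-↭ (↭-sym total) (Unique.allFin⁺ n))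

          step : ∀ {c} v → c ∈ hue ∷ map Cherry.hue Cs′ ⊎ (c ∈ map Claw.hue Ds′ ⊎ Doubled c (x ∷ body)) →
                 c ∈ map Cherry.hue Cs′ ⊎ (c ∈ map Claw.hue Ds′ ⊎ Doubled c (lf ∷ ctr ∷ rt ∷ v ∷ x ∷ body))
          step v (inj₁ (here refl)) = inj₂ (inj₂ (doubled-cherry C (v ∷ x ∷ body)))
          step v (inj₁ (there i))   = inj₁ i
          step v (inj₂ (inj₁ i))    = inj₂ (inj₁ i)
          step v (inj₂ (inj₂ h))    = inj₂ (inj₂ (doubled-++ʳ (lf ∷ ctr ∷ rt ∷ v ∷ []) h))

          attach : ∃₂ (λ v A′ → A ↭ v ∷ A′ × Good x v × Good rt v) → ⊥
          attach (v , A′ , A↭ , g , g′) = add-cherries Cs′ Cs′∈ Ds′ Ds′∈ A′ lf (ctr ∷ rt ∷ v ∷ x ∷ body)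
            (↭-trans (attach-cherry-↭ (concatMap Cherry.verts Cs′) (concatMap Claw.verts Ds′) A′ verts (v ∷ []) (x ∷ body ++ r₀ ∷ []))
              (↭-trans (++⁺ˡ (concatMap Cherry.verts (C ∷ Cs′)) (++⁺ˡ (concatMap Claw.verts Ds′) (++⁺ʳ (x ∷ body ++ r₀ ∷ []) (↭-sym A↭)))) total))
            A′⊆
            (≤-pred (≤-trans (≤-reflexive (sym (+-suc (4 * k) (length Cs′)))) (≤-trans big (≤-reflexive (↭-length A↭)))))
            (cherry-lf-degree C∈ A′ (AllPairs.tail (Unique-resp-↭ A↭ uniq)) A′⊆)
            (lf-ctr-good C∈ ∷ ctr-rt-good C∈ ∷ g′ ∷ g ∘ bad-sym ∷ linked)
            (λ c∈ → step v (has c∈))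
            where
            A′⊆ : All (_∈ R) A′
            A′⊆ = All.tail (All-resp-↭ A↭ A⊆)

      neighbour : ∀ x A → bad x A < length A → ∃₂ λ v A′ → A ↭ v ∷ A′ × Good x v
      neighbour x A lt =
        let v , v∈ , g = pick₁ (bad? x) A lt
            A′ , A↭ = extract v∈
        in v , A′ , A↭ , g

      R⊆pool : ∀ {v A} → R ↭ v ∷ A → All (_∈ pool) (v ∷ A)
      R⊆pool R↭ = All-resp-↭ R↭ (All.tabulate (∈-++⁺ʳ (map Claw.tip Ds)))

      -- The first star fixes both ends of the path: `lf` is the open end, and `r₀` is a vertex of
      -- `R` that is good for `rt`.
      start : ∀ Cs′ → All (_∈ Cs) Cs′ → ∀ Ds′ → All (_∈ Ds) Ds′ →
        concatMap Cherry.verts Cs′ ++ concatMap Claw.verts Ds′ ++ R ↭ allFin n →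
        4 * k + length Cs′ ≤ length R →
        (∀ {c} → c ∈ S → c ∈ map Cherry.hue Cs′ ⊎ c ∈ map Claw.hue Ds′) → ⊥
      start (C ∷ Cs′) (C∈ ∷ Cs′∈) Ds′ Ds′∈ total big has =
        begin-at (neighbour rt R (≤-<-trans (cherry-rt-degree C∈ R uniq R⊆)
          (<-≤-trans (≤-<-trans (m≤m+n (2 * k) (2 * k)) (2k+2k<4k+ (length Cs′))) big)))
        where
        open Cherry C

        R⊆ : All (_∈ R) R
        R⊆ = All.tabulate id

        uniq : Unique R
        uniq = Unique-resp-⊆
          (lf ∷ʳ ctr ∷ʳ rt ∷ʳ Sublist.++⁺ˡ (concatMap Cherry.verts Cs′) (Sublist.++⁺ˡ (concatMap Claw.verts Ds′) ⊆-refl))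
          (Unique-resp-↭ (↭-sym total) (Unique.allFin⁺ n))

        begin-at : ∃₂ (λ r₀ A → R ↭ r₀ ∷ A × Good rt r₀) → ⊥
        begin-at (r₀ , A , R↭ , g) = add-cherries r₀ (All.head (R⊆pool R↭)) Cs′ Cs′∈ Ds′ Ds′∈ A lf (ctr ∷ rt ∷ [])
          (↭-trans (attach-cherry-↭ (concatMap Cherry.verts Cs′) (concatMap Claw.verts Ds′) A verts (r₀ ∷ []) [])
            (↭-trans (++⁺ˡ (concatMap Cherry.verts (C ∷ Cs′)) (++⁺ˡ (concatMap Claw.verts Ds′)
              (↭-trans (↭-reflexive (++-identityʳ (r₀ ∷ A))) (↭-sym R↭)))) total))
          A⊆
          (≤-pred (≤-trans (≤-reflexive (sym (+-suc (4 * k) (length Cs′)))) (≤-trans big (≤-reflexive (↭-length R↭)))))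
          (cherry-lf-degree C∈ A (AllPairs.tail (Unique-resp-↭ R↭ uniq)) A⊆)
          (lf-ctr-good C∈ ∷ ctr-rt-good C∈ ∷ g ∷ [-])
          (λ c∈ → step (has c∈))
          where
          A⊆ : All (_∈ R) A
          A⊆ = All.tail (All-resp-↭ R↭ R⊆)

          step : ∀ {c} → c ∈ hue ∷ map Cherry.hue Cs′ ⊎ c ∈ map Claw.hue Ds′ →
                 c ∈ map Cherry.hue Cs′ ⊎ (c ∈ map Claw.hue Ds′ ⊎ Doubled c verts)
          step (inj₁ (here refl)) = inj₂ (inj₂ (doubled-cherry C []))
          step (inj₁ (there i))   = inj₁ i
          step (inj₂ i)           = inj₂ (inj₁ i)
      start [] _ (D ∷ Ds′) (D∈ ∷ Ds′∈) total big has =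
        begin-at (neighbour rt R (≤-<-trans (claw-rt-degree D∈ R uniq (All.tabulate (∈-++⁺ʳ (map Claw.tip Ds))))
          (≤-<-trans (m≤n+m k (2 * k)) (<-≤-trans (2k+k<4k k≥1) (≤-trans (m≤m+n (4 * k) 0) big)))))
        where
        open Claw D

        uniq : Unique (tip ∷ R)
        uniq = Unique-resp-⊆
          (refl ∷ lf ∷ʳ ctr ∷ʳ rt ∷ʳ Sublist.++⁺ˡ (concatMap Claw.verts Ds′) ⊆-refl)
          (Unique-resp-↭ (↭-sym total) (Unique.allFin⁺ n))

        begin-at : ∃₂ (λ r₀ A → R ↭ r₀ ∷ A × Good rt r₀) → ⊥
        begin-at (r₀ , A , R↭ , g) = add-claws r₀ (All.head (R⊆pool R↭)) Ds′ Ds′∈ (tip ∷ A) lf (ctr ∷ rt ∷ [])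
          (↭-trans (attach-claw-↭ (concatMap Claw.verts Ds′) (tip ∷ []) A (Cherry.verts cherry) (r₀ ∷ []) [])
            (↭-trans (++⁺ˡ (concatMap Claw.verts (D ∷ Ds′))
              (↭-trans (↭-reflexive (++-identityʳ (r₀ ∷ A))) (↭-sym R↭))) total))
          tipA⊆
          (≤-trans (m≤m+n (4 * k) 0) (≤-trans big (≤-reflexive (↭-length R↭))))
          (claw-lf-degree D∈ (tip ∷ A) (drop-second (Unique-resp-↭ (↭-prep tip R↭) uniq)) tipA⊆)
          (claw-lf-ctr-good D∈ ∷ claw-ctr-rt-good D∈ ∷ g ∷ [-])
          (λ c∈ → step (has c∈))
          where
          tipA⊆ : All (_∈ pool) (tip ∷ A)
          tipA⊆ = ∈-++⁺ˡ (∈-map⁺ Claw.tip D∈) ∷ All.tail (R⊆pool R↭)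

          step : ∀ {c} → c ∈ [] ⊎ c ∈ hue ∷ map Claw.hue Ds′ → c ∈ map Claw.hue Ds′ ⊎ Doubled c (Cherry.verts cherry)
          step (inj₂ (here refl)) = inj₂ (doubled-cherry cherry [])
          step (inj₂ (there i))   = inj₁ i
      -- With no star `S` is empty, yet `r₀` has more than `k` other vertices of `R` around it and
      -- hence a good edge.
      start [] _ [] _ total big has = isolated (inhabited R (≤-trans (s≤s z≤n) R>k))
        where
        R>k : suc k < length R
        R>k = ≤-trans (+-monoˡ-≤ k (*-monoʳ-≤ 2 k≥1))
                (≤-trans (<⇒≤ (2k+k<4k k≥1)) (≤-trans (m≤m+n (4 * k) 0) big))

        isolated : ∃ (_∈ R) → ⊥
        isolated (r₀ , r₀∈) with A , R↭ ← extract r₀∈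
          with v , _ , _ , g ← neighbour r₀ A (≤-<-trans
                 (pool-degree (All.head (R⊆pool R↭)) A (Unique-resp-↭ (↭-trans (↭-sym total) R↭) (Unique.allFin⁺ n)) (All.tail (R⊆pool R↭)))
                 (≤-pred (≤-trans R>k (≤-reflexive (↭-length R↭)))))
          = [ (λ ()) , (λ ()) ]′ (has (good→∈ g))

      some-hue-unused : ⊥
      some-hue-unused = start Cs (All.tabulate id) Ds (All.tabulate id) all-verts (R-large 4r≤n) (∈-++⁻ (map Cherry.hue Cs))

    impossible : ⊥
    impossible = by-cases K refl
      where
      by-cases : ∀ K′ → K ≡ K′ → ⊥
      by-cases []      eq = all-hues-used eq
      by-cases (_ ∷ _) eq = some-hue-unused (subst (λ K → 1 ≤ length K) (sym eq) (s≤s z≤n))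

-- Reaching a maximal configuration, and the lower bound

no-unique-colouring : ∀ {n r} (n≥3 : 3 ≤ n) → 4 * r ≤ n → (χ : Colouring n r) → ¬ UniqueColouring (cycle n n≥3) χ
no-unique-colouring {n} {r} n≥3 4r≤n χ unique = climb (suc (6 * r)) initial (m≤n+m (suc (6 * r)) (value initial))
  where
  open Configurations χ
  open Config

  initial : Config
  initial = record { Cs = [] ; Ds = [] ; R = allFin n ; K = allFin r ; all-verts = ↭-refl ; all-hues = ↭-refl }

  -- Each ascent raises the value by at least 1 and no value exceeds `6 * r`, so `suc (6 * r)` units
  -- of fuel suffice.
  climb : ∀ fuel F → 6 * r < value F + fuel → ⊥
  climb zero       F lt = <-irrefl refl (<-≤-trans lt (≤-trans (≤-reflexive (+-identityʳ _)) (value-bound F)))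
  climb (suc fuel) F lt = MaximalConfig.Assembly.impossible χ F
    -- Maximality of `F` is supplied by recursion: a configuration of higher value already leads to
    -- a contradiction.
    (λ G higher → climb fuel G (<-≤-trans lt (≤-trans (≤-reflexive (+-suc (value F) fuel)) (+-monoˡ-≤ fuel higher))))
    n≥3 4r≤n unique

unique-Ramsey-bound : ∀ {n r} (n≥3 : 3 ≤ n) → IsUniqueRamsey n (cycle n n≥3) r → n < r * 4
unique-Ramsey-bound {n} {r} n≥3 isR = ≰⇒> λ r*4≤n →
  no-unique-colouring n≥3 (≤-trans (≤-reflexive (*-comm 4 r)) r*4≤n) (proj₁ colouring) (proj₂ colouring)
  where colouring = proj₂ (IsUniqueRamsey.admissible isR)

theorem1p5 : (n : ℕ) (n≥4 : n ≥ 4) →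
    let n≥3 = <⇒≤ n≥4 in
    (+ rᵤ n (cycle n n≥3) (cycle-hasEdge n n≥3)) / 1 > (+ n) / 4
-- The comparison of fractions is cross-multiplied to `n * 1 < r * 4` over the integers.
theorem1p5 n n≥4 = *<* (subst₂ ℤ._<_ (sym (ℤ.*-identityʳ (+ n))) (ℤ.pos-* r 4)
  (+<+ (unique-Ramsey-bound n≥3 (rᵤ-isUniqueRamsey n (cycle n n≥3) edge))))
  where
  n≥3 = <⇒≤ n≥4
  edge = cycle-hasEdge n n≥3
  r = rᵤ n (cycle n n≥3) edge
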